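{- For any $A,B,B',C,C'\in\widehat{\mathbb{F}_q}$, any $x\in\mathbb{F}_q^*$, any $y\in\mathbb{F}_q$ and any $t\in\mathbb{F}_q^*\setminus\{1\}$, $$\frac{1}{q-1}\sum_{\theta}\binom{A\theta}{\theta}F_{2}(A\theta;B,B';C,C';x,y)\,\theta(t)=\overline{A}(1-t)\,F_{2}\left(A;B,B';C,C';\frac{x}{1-t},\frac{y}{1-t}\right)$$ $$\qquad-\overline{A}(-t)\,\overline{C'}(y)\,\overline{B'}C'(1-y)\,{}_{2}F_1\left(\begin{matrix}A,B\\ C\end{matrix}\bigg|\,-\frac{x}{t}\right)$$ $$\qquad-\overline{A}(-t)\left(\binom{B}{C}\binom{B'}{C'}\varepsilon(y)-F_{2}(\varepsilon;B,B';C,C';x,y)\right)$$ $$\qquad+BC(-1)\,\overline{A}(-x)\,\overline{C'}(y)\,\overline{B'}C'(1-y)\,{}_{2}F_1\left(\begin{matrix}A,A\overline{C}\\ A\overline{B}\end{matrix}\bigg|\,-\frac{t}{x}\right),$$ where $\theta$ ranges over all multiplicative characters of $\mathbb{F}_q$.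
   Context: Let $q$ be a power of a prime, $\mathbb{F}_q$ the field with $q$ elements, and $\widehat{\mathbb{F}_q}$ the group of (complex-valued) multiplicative characters of $\mathbb{F}_q^*$. Every character $\chi$, including the trivial character $\varepsilon$, is extended to $\mathbb{F}_q$ by $\chi(0)=0$. $\overline{\chi}$ denotes the inverse of $\chi$. Products of characters are evaluated pointwise, e.g. $\overline{B'}C'(1-y)=\overline{B'}(1-y)C'(1-y)$ and $BC(-1)=B(-1)C(-1)$. Jacobi sum: $J(\chi,\lambda)=\sum_{u\in\mathbb{F}_q}\chi(u)\lambda(1-u)$. Binomial coefficient of characters: $\binom{A}{B}=B(-1)J(A,\overline{B})$. Finite field ${}_2F_1$: for $A,B,C\in\widehat{\mathbb{F}_q}$ and $x\in\mathbb{F}_q$, $${}_{2}F_1\left(\begin{matrix}A,B\\ C\end{matrix}\bigg|\,x\right)=\varepsilon(x)\,BC(-1)\sum_{u\in\mathbb{F}_q}B(u)\,\overline{B}C(1-u)\,\overline{A}(1-xu).$$ The finite field Appell series $F_2$ is defined, for $A,B,B',C,C'\in\widehat{\mathbb{F}_q}$ and $x,y\in\mathbb{F}_q$, by $$F_{2}(A;B,B';C,C';x,y)=\varepsilon(xy)\,BB'CC'(-1)\sum_{u,v\in\mathbb{F}_q}B(u)B'(v)\,\overline{B}C(1-u)\,\overline{B'}C'(1-v)\,\overline{A}(1-ux-vy).$$ -}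

module Defs where

open import Level using (Level; suc; _⊔_)
open import Algebra.Bundles using (CommutativeRing; Semiring)
open import Algebra.Definitions using (Invertible)
open import Algebra.Apartness.Bundles using (HeytingCommutativeRing; HeytingField)
import Algebra.Apartness.Properties.HeytingCommutativeRing as HeytingProperties
import Algebra.Definitions.RawSemiring as RawSemiringDefinitions
import Algebra.Properties.CommutativeSemigroup as CommutativeSemigroupProperties
open import Data.Fin.Base using (Fin)
open import Data.Fin.Properties using (inj⇒≟)
open import Data.Nat.Base as ℕ using (ℕ; NonZero)
open import Data.Nat.Primality using (Prime)
open import Data.Product.Base using (∃-syntax; _×_; _,_; proj₁; proj₂)
open import Function.Bundles using (Inverse)
open import Function.Properties.Inverse using (Inverse⇒Injection)
import Function.Construct.Symmetry as Symmetry
open import Relation.Binary.Bundles using (Setoid)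
open import Relation.Binary.Definitions using (Decidable)
open import Relation.Binary.PropositionalEquality.Core using (_≡_)
open import Relation.Binary.PropositionalEquality.Properties using () renaming (setoid to ≡-setoid)
import Relation.Binary.Reasoning.Setoid as ≈-Reasoning
open import Relation.Nullary.Negation.Core using (¬_; contradiction)
open import Relation.Nullary.Decidable.Core using (yes; no)

IsPrimePower : ℕ → Set
IsPrimePower q = ∃[ p ] ∃[ n ] (Prime p × q ≡ p ℕ.^ ℕ.suc n)

-- A listing of S, up to its equality, without omissions or repetitions.
Enumeration : ∀ {c ℓ} → ℕ → Setoid c ℓ → Set (c ⊔ ℓ)
Enumeration n S = Inverse (≡-setoid (Fin n)) S

record FiniteField (q : ℕ) c ℓ : Set (suc (c ⊔ ℓ)) where
  field
    commutativeRing : CommutativeRing c ℓ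

  open CommutativeRing commutativeRing public

  field
    1≉0         : 1# ≉ 0#
    invertible  : ∀ {x} → x ≉ 0# → Invertible _≈_ 1# _*_ x
    enumeration : Enumeration q setoid

  open Inverse enumeration public using () renaming (to to element; from to index)

  infix 4 _≟_
  _≟_ : Decidable _≈_
  _≟_ = inj⇒≟ (Inverse⇒Injection (Symmetry.inverse enumeration))

  -- Junk value 0# at 0#.
  infix 9 _⁻¹
  _⁻¹ : Carrier → Carrier
  x ⁻¹ with x ≟ 0#
  ... | yes _   = 0#
  ... | no  x≉0 = proj₁ (invertible x≉0)

  infixl 7 _/_
  _/_ : Carrier → Carrier → Carrier
  x / y = x * y ⁻¹

  q-1-nonZero : NonZero (q ℕ.∸ 1)
  q-1-nonZero = go q element index (λ {x} → Inverse.strictlyInverseˡ enumeration x)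
    where
    go : ∀ n (f : Fin n → Carrier) (g : Carrier → Fin n) →
         (∀ {x} → f (g x) ≈ x) → NonZero (n ℕ.∸ 1)
    go ℕ.zero f g fg with () ← g 0#
    go (ℕ.suc ℕ.zero) f g fg with g 0# | g 1# | fg {0#} | fg {1#}
    ... | Fin.zero | Fin.zero | f0≈0 | f0≈1 = contradiction (trans (sym f0≈1) f0≈0) 1≉0
    go (ℕ.suc (ℕ.suc n)) f g fg = _

-- ℂ enters the theory of characters of 𝔽_q only as a field of characteristic
-- zero containing a primitive (q-1)-th root of unity; the values of characters
-- are taken in an arbitrary such field.  Using Heyting fields (non-zero means
-- apart from zero) rather than fields with decidable equality keeps the
-- constructive complex numbers among the instances.
module ValueField {k ℓ₁ ℓ₂} (K : HeytingField k ℓ₁ ℓ₂) where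
  open HeytingField K public
  open HeytingCommutativeRing heytingCommutativeRing public using (commutativeRing)
  open CommutativeRing commutativeRing using (semiring)
  open HeytingProperties heytingCommutativeRing using (x-0≈x)
  open RawSemiringDefinitions (Semiring.rawSemiring semiring) public using (_^_; sum) renaming (_×_ to _·_)

  CharacteristicZero : Set ℓ₂
  CharacteristicZero = ∀ n → .{{NonZero n}} → n · 1# # 0#

  IsPrimitiveRoot : ℕ → Carrier → Set (ℓ₁ ⊔ ℓ₂)
  IsPrimitiveRoot n ζ = ζ ^ n ≈ 1# × (∀ j → 0 ℕ.< j → j ℕ.< n → ζ ^ j # 1#)

  recip : ∀ {x} → x # 0# → Carrier
  recip x#0 = proj₁ (#⇒invertible x#0)

  recip-inverseˡ : ∀ {x} (x#0 : x # 0#) → recip x#0 * x ≈ 1#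
  recip-inverseˡ {x} x#0 =
    trans (*-congˡ (sym (x-0≈x x))) (proj₁ (proj₂ (#⇒invertible x#0)))

module Characters {q c ℓ k ℓ₁ ℓ₂} (𝔽 : FiniteField q c ℓ) (K : HeytingField k ℓ₁ ℓ₂) where
  module F = FiniteField 𝔽
  open ValueField K public
  open CommutativeRing commutativeRing using (*-commutativeSemigroup)
  open HeytingProperties heytingCommutativeRing
    using (1#0; x#0y#0→xy#0; invertibleʳ⇒#; x-0≈x)
  open CommutativeSemigroupProperties *-commutativeSemigroup using (interchange)

  -- A homomorphism from the nonzero elements of 𝔽 to those of K, extended by 0 at 0.
  record Character : Set (c ⊔ ℓ ⊔ k ⊔ ℓ₁ ⊔ ℓ₂) where
    infixl 9 _⟨_⟩
    field
      _⟨_⟩    : F.Carrier → Carrier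
      cong    : ∀ {x y} → x F.≈ y → _⟨_⟩ x ≈ _⟨_⟩ y
      nonzero : ∀ {x} → x F.≉ F.0# → _⟨_⟩ x # 0#
      homo    : ∀ {x y} → x F.≉ F.0# → y F.≉ F.0# → _⟨_⟩ (x F.* y) ≈ _⟨_⟩ x * _⟨_⟩ y
      at-zero : _⟨_⟩ F.0# ≈ 0#

  open Character public using (_⟨_⟩)

  characterSetoid : Setoid (c ⊔ ℓ ⊔ k ⊔ ℓ₁ ⊔ ℓ₂) (c ⊔ ℓ₁)
  characterSetoid = record
    { Carrier       = Character
    ; _≈_           = λ χ λ′ → ∀ x → χ ⟨ x ⟩ ≈ λ′ ⟨ x ⟩
    ; isEquivalence = record
      { refl  = λ _ → refl
      ; sym   = λ p x → sym (p x)
      ; trans = λ p r x → trans (p x) (r x)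
      }
    }

  x*y≉0 : ∀ {x y} → x F.≉ F.0# → y F.≉ F.0# → x F.* y F.≉ F.0#
  x*y≉0 {x} {y} x≉0 y≉0 xy≈0 = y≉0 (begin
    y                     ≈⟨ F.*-identityˡ y ⟨
    F.1# F.* y            ≈⟨ F.*-congʳ x⁻¹x≈1 ⟨
    (x⁻¹ F.* x) F.* y     ≈⟨ F.*-assoc x⁻¹ x y ⟩
    x⁻¹ F.* (x F.* y)     ≈⟨ F.*-congˡ xy≈0 ⟩
    x⁻¹ F.* F.0#          ≈⟨ F.zeroʳ x⁻¹ ⟩
    F.0#                  ∎)
    where
    open ≈-Reasoning F.setoid
    x⁻¹ = proj₁ (F.invertible x≉0)
    x⁻¹x≈1 = proj₁ (proj₂ (F.invertible x≉0))

  inverse-unique : ∀ {x y y′} → y * x ≈ 1# → y′ * x ≈ 1# → y ≈ y′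
  inverse-unique {x} {y} {y′} yx≈1 y′x≈1 = begin
    y             ≈⟨ *-identityʳ y ⟨
    y * 1#        ≈⟨ *-congˡ y′x≈1 ⟨
    y * (y′ * x)  ≈⟨ *-congˡ (*-comm y′ x) ⟩
    y * (x * y′)  ≈⟨ *-assoc y x y′ ⟨
    (y * x) * y′  ≈⟨ *-congʳ yx≈1 ⟩
    1# * y′       ≈⟨ *-identityˡ y′ ⟩
    y′            ∎
    where open ≈-Reasoning setoid

  ε-value : F.Carrier → Carrier
  ε-value x with x F.≟ F.0#
  ... | yes _ = 0#
  ... | no  _ = 1#

  ε : Character
  ε = record
    { _⟨_⟩ = ε-value ; cong = ε-cong ; nonzero = ε-nonzero ; homo = ε-homo ; at-zero = ε-zero }
    where
    ε-cong : ∀ {x y} → x F.≈ y → ε-value x ≈ ε-value y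
    ε-cong {x} {y} x≈y with x F.≟ F.0# | y F.≟ F.0#
    ... | yes _   | yes _   = refl
    ... | no  _   | no  _   = refl
    ... | yes x≈0 | no  y≉0 = contradiction (F.trans (F.sym x≈y) x≈0) y≉0
    ... | no  x≉0 | yes y≈0 = contradiction (F.trans x≈y y≈0) x≉0

    ε-nonzero : ∀ {x} → x F.≉ F.0# → ε-value x # 0#
    ε-nonzero {x} x≉0 with x F.≟ F.0#
    ... | yes x≈0 = contradiction x≈0 x≉0
    ... | no  _   = 1#0

    ε-homo : ∀ {x y} → x F.≉ F.0# → y F.≉ F.0# → ε-value (x F.* y) ≈ ε-value x * ε-value y
    ε-homo {x} {y} x≉0 y≉0 with x F.≟ F.0# | y F.≟ F.0# | x F.* y F.≟ F.0#
    ... | yes x≈0 | _       | _        = contradiction x≈0 x≉0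
    ... | no  _   | yes y≈0 | _        = contradiction y≈0 y≉0
    ... | no  _   | no  _   | yes xy≈0 = contradiction xy≈0 (x*y≉0 x≉0 y≉0)
    ... | no  _   | no  _   | no  _    = sym (*-identityˡ 1#)

    ε-zero : ε-value F.0# ≈ 0#
    ε-zero with F.0# F.≟ F.0#
    ... | yes _   = refl
    ... | no  0≉0 = contradiction F.refl 0≉0

  infixl 7 _∙_
  _∙_ : Character → Character → Character
  χ ∙ ψ = record
    { _⟨_⟩    = λ x → χ ⟨ x ⟩ * ψ ⟨ x ⟩
    ; cong    = λ x≈y → *-cong (χ.cong x≈y) (ψ.cong x≈y)
    ; nonzero = λ x≉0 → x#0y#0→xy#0 (χ.nonzero x≉0) (ψ.nonzero x≉0)
    ; homo    = λ x≉0 y≉0 → trans (*-cong (χ.homo x≉0 y≉0) (ψ.homo x≉0 y≉0)) (interchange _ _ _ _)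
    ; at-zero = trans (*-congʳ χ.at-zero) (zeroˡ _)
    }
    where
    module χ = Character χ
    module ψ = Character ψ

  inverse-value : Character → F.Carrier → Carrier
  inverse-value χ x with x F.≟ F.0#
  ... | yes _   = 0#
  ... | no  x≉0 = recip (Character.nonzero χ x≉0)

  infix 10 _⁻¹
  _⁻¹ : Character → Character
  χ ⁻¹ = record
    { _⟨_⟩ = inverse-value χ ; cong = inv-cong ; nonzero = inv-nonzero ; homo = inv-homo ; at-zero = inv-zero }
    where
    module χ = Character χ

    inv-cong : ∀ {x y} → x F.≈ y → inverse-value χ x ≈ inverse-value χ y
    inv-cong {x} {y} x≈y with x F.≟ F.0# | y F.≟ F.0#
    ... | yes _   | yes _   = refl
    ... | yes x≈0 | no  y≉0 = contradiction (F.trans (F.sym x≈y) x≈0) y≉0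
    ... | no  x≉0 | yes y≈0 = contradiction (F.trans x≈y y≈0) x≉0
    ... | no  x≉0 | no  y≉0 = inverse-unique (recip-inverseˡ (χ.nonzero x≉0))
      (trans (*-congˡ (χ.cong x≈y)) (recip-inverseˡ (χ.nonzero y≉0)))

    inv-nonzero : ∀ {x} → x F.≉ F.0# → inverse-value χ x # 0#
    inv-nonzero {x} x≉0 with x F.≟ F.0#
    ... | yes x≈0 = contradiction x≈0 x≉0
    ... | no  x≉0′ = invertibleʳ⇒#
      (χ ⟨ x ⟩ , trans (*-congʳ (x-0≈x _)) (recip-inverseˡ (χ.nonzero x≉0′)))

    inv-homo : ∀ {x y} → x F.≉ F.0# → y F.≉ F.0# →
               inverse-value χ (x F.* y) ≈ inverse-value χ x * inverse-value χ y
    inv-homo {x} {y} x≉0 y≉0 with x F.≟ F.0# | y F.≟ F.0# | x F.* y F.≟ F.0#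
    ... | yes x≈0 | _       | _        = contradiction x≈0 x≉0
    ... | no  _   | yes y≈0 | _        = contradiction y≈0 y≉0
    ... | no  _   | no  _   | yes xy≈0 = contradiction xy≈0 (x*y≉0 x≉0 y≉0)
    ... | no  x≉0′ | no y≉0′ | no xy≉0 = inverse-unique (recip-inverseˡ (χ.nonzero xy≉0)) (begin
      rx * ry * (χ ⟨ x F.* y ⟩)        ≈⟨ *-congˡ (χ.homo x≉0 y≉0) ⟩
      rx * ry * (χ ⟨ x ⟩ * χ ⟨ y ⟩)    ≈⟨ interchange rx ry _ _ ⟩
      (rx * χ ⟨ x ⟩) * (ry * χ ⟨ y ⟩)  ≈⟨ *-cong (recip-inverseˡ _) (recip-inverseˡ _) ⟩
      1# * 1#                          ≈⟨ *-identityˡ 1# ⟩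
      1#                               ∎)
      where
      open ≈-Reasoning setoid
      rx = recip (χ.nonzero x≉0′)
      ry = recip (χ.nonzero y≉0′)

    inv-zero : inverse-value χ F.0# ≈ 0#
    inv-zero with F.0# F.≟ F.0#
    ... | yes _   = refl
    ... | no  0≉0 = contradiction F.refl 0≉0

  ∑𝔽 : (F.Carrier → Carrier) → Carrier
  ∑𝔽 f = sum (λ i → f (F.element i))

  syntax ∑𝔽 (λ u → e) = ∑𝔽[ u ] e

  ∑-characters : ∀ {m} → Enumeration m characterSetoid → (Character → Carrier) → Carrier
  ∑-characters characters f = sum (λ i → f (Inverse.to characters i))

  syntax ∑-characters characters (λ θ → e) = ∑[ θ ∈ characters ] e

  -1F : F.Carrier
  -1F = F.- F.1#

  J : Character → Character → Carrier
  J χ ψ = ∑𝔽[ u ] (χ ⟨ u ⟩ * ψ ⟨ F.1# F.- u ⟩)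

  binom : Character → Character → Carrier
  binom A B = B ⟨ -1F ⟩ * J A (B ⁻¹)

  ₂F₁ : (A B C : Character) → F.Carrier → Carrier
  ₂F₁ A B C x =
    ε ⟨ x ⟩ * (B ∙ C) ⟨ -1F ⟩ *
    ∑𝔽[ u ] (B ⟨ u ⟩ * (B ⁻¹ ∙ C) ⟨ F.1# F.- u ⟩ * A ⁻¹ ⟨ F.1# F.- x F.* u ⟩)

  F₂ : (A B B′ C C′ : Character) → F.Carrier → F.Carrier → Carrier
  F₂ A B B′ C C′ x y =
    ε ⟨ x F.* y ⟩ * (B ∙ B′ ∙ C ∙ C′) ⟨ -1F ⟩ *
    ∑𝔽[ u ] ∑𝔽[ v ]
      (B ⟨ u ⟩ * B′ ⟨ v ⟩ * (B ⁻¹ ∙ C) ⟨ F.1# F.- u ⟩ * (B′ ⁻¹ ∙ C′) ⟨ F.1# F.- v ⟩ *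
       A ⁻¹ ⟨ F.1# F.- u F.* x F.- v F.* y ⟩)

  1/[q-1] : CharacteristicZero → Carrier
  1/[q-1] char0 = recip (char0 (q ℕ.∸ 1) {{F.q-1-nonZero}})

{-# OPTIONS --safe #-}

-- Expanding the binomial coefficient and F₂ on the left as character sums and
-- summing over θ first, orthogonality selects the w with -tw = (1-w)s, where
-- s = 1 - ux - vy.  For s ≠ 0 this leaves exactly the term A⁻¹(s - t), and for
-- s = 0 nothing, so the left-hand side is the F₂-integral with A⁻¹(s) replaced by
-- A⁻¹(s - t) - A⁻¹(-t)(1 - ε(s)).  Since s - t = (1-t)(1 - ux/(1-t) - vy/(1-t)),
-- this is the first minus the third term of the right-hand side; the two ₂F₁-terms
-- cancel by the substitution u ↦ 1/u.
-- Orthogonality needs a character separating x ≠ 1 from 1.  It is ζ raised to the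
-- discrete logarithm: 𝔽* is cyclic because X^(n+1) - X has at most n + 1 roots,
-- so that an element of order n < q - 1 gives rise to one of larger order.
module Submission where

open import Algebra.Apartness.Bundles using (HeytingField)
import Algebra.Apartness.Properties.HeytingCommutativeRing as HeytingProperties
open import Algebra.Bundles using (CommutativeRing; CommutativeSemiring)
import Algebra.Properties.CommutativeSemigroup as CommutativeSemigroupProperties
import Algebra.Properties.CommutativeSemiring.Exp as Exponentiation
import Algebra.Properties.Ring as RingProperties
import Algebra.Properties.Semiring.Sum as Sum
import Algebra.Solver.CommutativeMonoid as CommutativeMonoidSolver
import Algebra.Solver.Ring.NaturalCoefficients.Default as NaturalSolver
open import Data.Fin.Base as Fin using (Fin)
open import Data.Fin.Permutation using (Permutation)
import Data.Fin.Properties as Fin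
open import Data.List.Base using ([]; _∷_)
open import Data.List.Relation.Unary.All using (_∷_)
open import Data.Nat.Base as ℕ using (ℕ; zero; suc; NonZero; _∸_)
open import Data.Nat.Coprimality as Coprimality using (Coprime)
open import Data.Nat.Divisibility as ∣ using (_∣_; _∤_; divides)
import Data.Nat.DivMod as DivMod
open import Data.Nat.GCD using (gcd; gcd[m,n]∣m; gcd[m,n]∣n; gcd[m,n]≢0)
open import Data.Nat.Induction using (<-wellFounded)
open import Data.Nat.Primality as Primality using (Prime)
open import Data.Nat.Primality.Factorisation using (factorise)
import Data.Nat.Properties as ℕ
open import Data.Product.Base using (∃; ∃₂; _×_; _,_; proj₁; proj₂)
open import Data.Sum.Base using (_⊎_; inj₁; inj₂)
open import Data.Vec.Base as Vec using (Vec; []; _∷_)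
import Data.Vec.Functional as Vector
open import Function.Base using (_∘_)
open import Function.Bundles using (Inverse; Injection)
import Function.Construct.Composition as Composition
import Function.Construct.Symmetry as Symmetry
open import Function.Properties.Inverse using (Inverse⇒Injection)
open import Induction.WellFounded using (Acc; acc)
open import Relation.Binary.Bundles using (Setoid)
open import Relation.Binary.Definitions using (Decidable; tri<; tri≈; tri>)
open import Relation.Binary.PropositionalEquality as ≡ using (_≡_; _≢_)
import Relation.Binary.Reasoning.Setoid as SetoidReasoning
open import Relation.Nullary.Decidable.Core using (Dec; yes; no; _⊎-dec_)
open import Relation.Nullary.Negation.Core using (¬_; contradiction)
open import Defs

-- The third term comes from the two halves of the correction `1 - ε(s)`: its constant half leaves a
-- double sum that splits into two single sums, which become binomials under u ↦ u/(u - 1), and its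
-- `ε(s)` half is the integral of `F₂ ε`. Equality in `K` cannot be decided, so no argument may ask
-- whether a character value is 1 or whether a sum is 0. Vanishing is obtained from tightness
-- instead: a sum S apart from 0 could be cancelled from c S = S, which would force c = 1. The
-- length `m` of the list of characters is not given as q - 1. That the values θ(1) add up to q - 1
-- is a consequence of orthogonality in both variables, and it is what matches the factor 1/(q - 1).
-- Zero is its own inverse by the junk value. Hence 1/u and u/(u - 1) are bijections of the whole
-- field, and at the exceptional point, which they fix, both integrands vanish.

-- Coprimality and prime powers in the natural numbers.

prime-divisor : ∀ n → .{{NonZero n}} → n ≢ 1 → ∃ λ p → Prime p × p ∣ n
prime-divisor n n≢1 with factorise n
... | record { factors = [] ; isFactorisation = n≡1 } = contradiction n≡1 n≢1
... | record { factors = p ∷ ps ; isFactorisation = n≡ ; factorsPrime = pr ∷ _ } =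
  p , pr , ≡.subst (p ∣_) (≡.sym n≡) (∣.m∣m*n _)

coprime-*ˡ : ∀ {m k n} → Coprime m n → Coprime k n → Coprime (m ℕ.* k) n
coprime-*ˡ m⊥n k⊥n (d∣mk , d∣n) =
  k⊥n (Coprimality.coprime-divisor (λ (e∣d , e∣m) → m⊥n (e∣m , ∣.∣-trans e∣d d∣n)) d∣mk , d∣n)

coprime-^ˡ : ∀ {m n} j → Coprime m n → Coprime (m ℕ.^ j) n
coprime-^ˡ zero    m⊥n = Coprimality.1-coprimeTo _
coprime-^ˡ (suc j) m⊥n = coprime-*ˡ m⊥n (coprime-^ˡ j m⊥n)

prime∤⇒coprime : ∀ {p n} → Prime p → p ∤ n → Coprime p n
prime∤⇒coprime {p} pr p∤n (d∣p , d∣n) with Primality.prime⇒irreducible pr d∣p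
... | inj₁ d≡1 = d≡1
... | inj₂ ≡.refl = contradiction d∣n p∤n

*-coprime-∣ : ∀ {m n k} → Coprime m n → m ∣ k → n ∣ k → m ℕ.* n ∣ k
*-coprime-∣ {m} {n} m⊥n (divides j ≡.refl) n∣k =
  ≡.subst (m ℕ.* n ∣_) (ℕ.*-comm m j)
    (∣.*-monoʳ-∣ m (Coprimality.coprime-divisor (Coprimality.sym m⊥n) (≡.subst (n ∣_) (ℕ.*-comm j m) n∣k)))

prime-power-part : ∀ {p} → Prime p → ∀ n → .{{NonZero n}} →
                   ∃₂ λ j n′ → n ≡ p ℕ.^ j ℕ.* n′ × p ∤ n′
prime-power-part {p} pr n = go n (<-wellFounded n)
  where
  go : ∀ n → Acc ℕ._<_ n → .{{NonZero n}} → ∃₂ λ j n′ → n ≡ p ℕ.^ j ℕ.* n′ × p ∤ n′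
  go n (acc rec) with p ∣.∣? n
  ... | no p∤n = 0 , n , ≡.sym (ℕ.+-identityʳ n) , p∤n
  ... | yes p∣n@(divides k ≡.refl) =
    let instance
          k≢0 : NonZero k
          k≢0 = ℕ.m*n≢0⇒m≢0 k
        j , n′ , k≡ , p∤n′ = go k (rec (ℕ.m<m*n k p (ℕ.nonTrivial⇒n>1 p {{Primality.prime⇒nonTrivial pr}})))
    in suc j , n′ , ≡.trans (ℕ.*-comm k p) (≡.trans (≡.cong (p ℕ.*_) k≡) (≡.sym (ℕ.*-assoc p (p ℕ.^ j) n′))) , p∤n′

-- With `g` the gcd, `m / g` is not 1 and so has a prime divisor `p`. This `p` does not divide the
-- coprime number `n / g`, so all factors `p` of `n` lie in `g`; together with the one in `m / g`
-- they give `m` one factor more than `n`.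
larger-prime-power : ∀ m n → .{{NonZero m}} → .{{NonZero n}} → m ∤ n →
                     ∃ λ p → Prime p × ∃₂ λ j n′ → n ≡ p ℕ.^ j ℕ.* n′ × p ∤ n′ × p ℕ.^ suc j ∣ m
larger-prime-power m n m∤n =
  let p , pr , p∣m₁ = prime-divisor m₁ m₁≢1
      p∤n₁ = λ p∣n₁ → ℕ.nonTrivial⇒≢1 {{Primality.prime⇒nonTrivial pr}} (m₁⊥n₁ (p∣m₁ , p∣n₁))
      j , n′ , n≡ , p∤n′ = prime-power-part pr n
      pʲ∣g = Coprimality.coprime-divisor (coprime-^ˡ j (prime∤⇒coprime pr p∤n₁))
        (≡.subst (p ℕ.^ j ∣_) (≡.sym n₁*g≡n) (≡.subst (p ℕ.^ j ∣_) (≡.sym n≡) (∣.m∣m*n n′)))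
  in p , pr , j , n′ , n≡ , p∤n′ , ≡.subst (p ℕ.^ suc j ∣_) m₁*g≡m (∣.*-pres-∣ p∣m₁ pʲ∣g)
  where
  g = gcd m n
  instance
    g≢0 : NonZero g
    g≢0 = ℕ.≢-nonZero (gcd[m,n]≢0 m n (inj₁ (ℕ.≢-nonZero⁻¹ m)))
  m₁ = m DivMod./ g
  n₁ = n DivMod./ g
  m₁*g≡m : m₁ ℕ.* g ≡ m
  m₁*g≡m = DivMod.m/n*n≡m (gcd[m,n]∣m m n)
  n₁*g≡n : n₁ ℕ.* g ≡ n
  n₁*g≡n = DivMod.m/n*n≡m (gcd[m,n]∣n m n)
  m₁⊥n₁ : Coprime m₁ n₁
  m₁⊥n₁ = Coprimality.coprime-/gcd m n
  m₁≢1 : m₁ ≢ 1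
  m₁≢1 m₁≡1 = m∤n (≡.subst (_∣ n)
    (≡.trans (≡.sym (ℕ.*-identityˡ g)) (≡.trans (≡.cong (ℕ._* g) (≡.sym m₁≡1)) m₁*g≡m)) (gcd[m,n]∣n m n))
  instance
    m₁≢0 : NonZero m₁
    m₁≢0 = ℕ.m*n≢0⇒m≢0 m₁ {{≡.subst NonZero (≡.sym m₁*g≡m) (ℕ.≢-nonZero (ℕ.≢-nonZero⁻¹ m))}}

-- Multiplicative orders.

module Orders {c ℓ} (R : CommutativeSemiring c ℓ) where
  open CommutativeSemiring R
  open Exponentiation R
  open SetoidReasoning setoid

  -- Minimality is expressed by divisibility, so that orders of powers and products reduce to
  -- divisibility of natural numbers. The value `n = 0` would describe an element of infinite order
  -- and is excluded by `order≢0`.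
  record HasOrder (x : Carrier) (n : ℕ) : Set ℓ where
    field
      order≢0 : NonZero n
      x^n≈1   : x ^ n ≈ 1#
      x^k≈1⇒n∣k : ∀ k → x ^ k ≈ 1# → n ∣ k

  1^n≈1 : ∀ n → 1# ^ n ≈ 1#
  1^n≈1 zero    = refl
  1^n≈1 (suc n) = trans (*-identityˡ _) (1^n≈1 n)

  x^n≈1⇒x^[n*k]≈1 : ∀ {x} n k → x ^ n ≈ 1# → x ^ (n ℕ.* k) ≈ 1#
  x^n≈1⇒x^[n*k]≈1 {x} n k x^n≈1 = begin
    x ^ (n ℕ.* k)  ≈⟨ ^-assocʳ x n k ⟨
    (x ^ n) ^ k    ≈⟨ ^-congˡ k x^n≈1 ⟩
    1# ^ k         ≈⟨ 1^n≈1 k ⟩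
    1#             ∎

  -- Descent: a smaller positive exponent replaces `k` as long as there is one. When there is none,
  -- a non-zero remainder modulo `k` would be such an exponent, so all remainders vanish.
  order-exists : Decidable _≈_ → ∀ x k → .{{NonZero k}} → x ^ k ≈ 1# → ∃ λ n → HasOrder x n
  order-exists _≟_ x k = go k (<-wellFounded k)
    where
    go : ∀ k → Acc ℕ._<_ k → .{{NonZero k}} → x ^ k ≈ 1# → ∃ λ n → HasOrder x n
    -- The shift by one makes the search range over the exponents strictly between 0 and `k`.
    go k@(suc k-1) (acc rec) x^k≈1 with ℕ.anyUpTo? (λ i → (x ^ suc i) ≟ 1#) k-1
    ... | yes (i , i<k-1 , x^i≈1) = go (suc i) (rec (ℕ.s≤s i<k-1)) x^i≈1
    ... | no least = k , record
      { order≢0   = _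
      ; x^n≈1     = x^k≈1
      ; x^k≈1⇒n∣k = λ j x^j≈1 → ∣.m%n≡0⇒n∣m j k (remainder≡0 j x^j≈1 (j DivMod.% k) ≡.refl)
      }
      where
      remainder≡0 : ∀ j → x ^ j ≈ 1# → ∀ r → r ≡ j DivMod.% k → r ≡ 0
      remainder≡0 j x^j≈1 zero    _  = ≡.refl
      remainder≡0 j x^j≈1 (suc r) r≡ = contradiction
        (r , ℕ.s<s⁻¹ (≡.subst (ℕ._< k) (≡.sym r≡) (DivMod.m%n<n j k)) , (begin
          x ^ suc r                                   ≈⟨ *-identityʳ _ ⟨
          x ^ suc r * 1#                              ≈⟨ *-congˡ (x^n≈1⇒x^[n*k]≈1 k (j DivMod./ k) x^k≈1) ⟨
          x ^ suc r * x ^ (k ℕ.* (j DivMod./ k))      ≈⟨ ^-homo-* x (suc r) _ ⟨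
          x ^ (suc r ℕ.+ k ℕ.* (j DivMod./ k))        ≈⟨ ^-congʳ x (≡.cong₂ ℕ._+_ r≡ (ℕ.*-comm k _)) ⟩
          x ^ (j DivMod.% k ℕ.+ j DivMod./ k ℕ.* k)   ≈⟨ ^-congʳ x (DivMod.m≡m%n+[m/n]*n j k) ⟨
          x ^ j                                       ≈⟨ x^j≈1 ⟩
          1#                                          ∎))
        least

  order-^ : ∀ {x} d n → HasOrder x (d ℕ.* n) → HasOrder (x ^ d) n
  order-^ {x} d n o = record
    { order≢0   = ℕ.m*n≢0⇒n≢0 d {{order≢0}}
    ; x^n≈1     = trans (^-assocʳ x d n) x^n≈1
    ; x^k≈1⇒n∣k = λ k eq → ∣.*-cancelˡ-∣ d {{ℕ.m*n≢0⇒m≢0 d {{order≢0}}}}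
        (x^k≈1⇒n∣k (d ℕ.* k) (trans (sym (^-assocʳ x d k)) eq))
    }
    where open HasOrder o

  -- Raising to the power `n` removes `y`, so `m` divides `n * k`, and coprimality removes `n`.
  order-*-∣ : ∀ {x y m n} → Coprime m n → HasOrder x m → HasOrder y n →
              ∀ k → (x * y) ^ k ≈ 1# → m ∣ k
  order-*-∣ {x} {y} {m} {n} m⊥n x-order y-order k [xy]^k≈1 =
    Coprimality.coprime-divisor m⊥n (HasOrder.x^k≈1⇒n∣k x-order (n ℕ.* k) (begin
      x ^ (n ℕ.* k)                    ≈⟨ *-identityʳ _ ⟨
      x ^ (n ℕ.* k) * 1#               ≈⟨ *-congˡ (x^n≈1⇒x^[n*k]≈1 n k (HasOrder.x^n≈1 y-order)) ⟨
      x ^ (n ℕ.* k) * y ^ (n ℕ.* k)    ≈⟨ ^-distrib-* x y (n ℕ.* k) ⟨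
      (x * y) ^ (n ℕ.* k)              ≈⟨ ^-congʳ (x * y) (ℕ.*-comm n k) ⟩
      (x * y) ^ (k ℕ.* n)              ≈⟨ x^n≈1⇒x^[n*k]≈1 k n [xy]^k≈1 ⟩
      1#                               ∎))

  order-* : ∀ {x y m n} → Coprime m n → HasOrder x m → HasOrder y n → HasOrder (x * y) (m ℕ.* n)
  order-* {x} {y} {m} {n} m⊥n x-order y-order = record
    { order≢0   = ℕ.m*n≢0 m n {{X.order≢0}} {{Y.order≢0}}
    ; x^n≈1     = begin
        (x * y) ^ (m ℕ.* n)              ≈⟨ ^-distrib-* x y (m ℕ.* n) ⟩
        x ^ (m ℕ.* n) * y ^ (m ℕ.* n)    ≈⟨ *-cong (x^n≈1⇒x^[n*k]≈1 m n X.x^n≈1)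
                                                   (trans (^-congʳ y (ℕ.*-comm m n)) (x^n≈1⇒x^[n*k]≈1 n m Y.x^n≈1)) ⟩
        1# * 1#                          ≈⟨ *-identityˡ 1# ⟩
        1#                               ∎
    ; x^k≈1⇒n∣k = λ k [xy]^k≈1 → *-coprime-∣ m⊥n
        (order-*-∣ m⊥n x-order y-order k [xy]^k≈1)
        (order-*-∣ (Coprimality.sym m⊥n) y-order x-order k (trans (^-congˡ k (*-comm y x)) [xy]^k≈1))
    }
    where
    module X = HasOrder x-order
    module Y = HasOrder y-order

  -- If p ^ j is the exact power of p in n, while p ^ suc j divides m, then the
  -- p-part of x times the prime-to-p part of y has order p * n.
  larger-order : ∀ {x y m n} → HasOrder x m → HasOrder y n → m ∤ n →
                 ∃₂ λ z k → n ℕ.< k × HasOrder z k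
  larger-order {x} {y} {m} {n} x-order y-order m∤n
    with larger-prime-power m n {{HasOrder.order≢0 x-order}} {{HasOrder.order≢0 y-order}} m∤n
  ... | p , pr , j , n′ , ≡.refl , p∤n′ , divides d ≡.refl =
    x ^ d * y ^ (p ℕ.^ j) , p ℕ.^ suc j ℕ.* n′ , n<pn ,
    order-* (coprime-^ˡ (suc j) (prime∤⇒coprime pr p∤n′)) (order-^ d _ x-order) (order-^ (p ℕ.^ j) n′ y-order)
    where
    n<pn : p ℕ.^ j ℕ.* n′ ℕ.< p ℕ.* p ℕ.^ j ℕ.* n′
    n<pn = ≡.subst₂ ℕ._<_ ≡.refl
      (≡.trans (ℕ.*-comm (p ℕ.^ j ℕ.* n′) p) (≡.sym (ℕ.*-assoc p (p ℕ.^ j) n′)))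
      (ℕ.m<m*n (p ℕ.^ j ℕ.* n′) p {{HasOrder.order≢0 y-order}}
        (ℕ.nonTrivial⇒n>1 p {{Primality.prime⇒nonTrivial pr}}))

-- Division of monic polynomials by linear factors.

-- A monic polynomial of degree n is given by its n lower coefficients, the
-- constant one first.
module MonicPolynomials {c ℓ} (R : CommutativeRing c ℓ) where
  open CommutativeRing R
  open NaturalSolver commutativeSemiring
  open SetoidReasoning setoid

  eval : ∀ {n} → Vec Carrier n → Carrier → Carrier
  eval []       x = 1#
  eval (a ∷ as) x = x * eval as x + a

  eval-cong : ∀ {n} (as : Vec Carrier n) {x y} → x ≈ y → eval as x ≈ eval as y
  eval-cong []       x≈y = refl
  eval-cong (a ∷ as) x≈y = +-congʳ (*-cong x≈y (eval-cong as x≈y))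

  -- Synthetic division by X - r: the coefficients of the quotient are the intermediate values of
  -- Horner's scheme at `r`.
  quotient : ∀ {n} → Vec Carrier (suc n) → Carrier → Vec Carrier n
  quotient (a ∷ [])            r = []
  quotient (a ∷ as@(_ ∷ _))    r = eval as r ∷ quotient as r

  -- This is P(x) = P(r) + (x - r) Q(x) with x written as `r + d`. The form is free of subtraction
  -- and thus within reach of a solver for semirings.
  eval-+ : ∀ {n} (as : Vec Carrier (suc n)) r d →
           eval as (r + d) ≈ eval as r + d * eval (quotient as r) (r + d)
  eval-+ (a ∷ []) r d = solve 3 (λ a r d → (r :+ d) :* con 1 :+ a := r :* con 1 :+ a :+ d :* con 1) refl a r d
  eval-+ (a ∷ as@(_ ∷ _)) r d = begin
    (r + d) * eval as (r + d) + a              ≈⟨ +-congʳ (*-congˡ (eval-+ as r d)) ⟩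
    (r + d) * (eval as r + d * h) + a          ≈⟨ solve 5 (λ a r d e h →
                                                   (r :+ d) :* (e :+ d :* h) :+ a :=
                                                   r :* e :+ a :+ d :* ((r :+ d) :* h :+ e)) refl a r d (eval as r) h ⟩
    r * eval as r + a + d * ((r + d) * h + eval as r) ∎
    where h = eval (quotient as r) (r + d)

-- Inverses in a finite field and cyclicity of its multiplicative group.

module FiniteFieldProperties {q c ℓ} (𝔽 : FiniteField q c ℓ) where
  open FiniteField 𝔽
  open RingProperties ring using (+-identityʳ-unique; x∙y⁻¹≈ε⇒x≈y; //-rightDividesˡ)
  open Exponentiation commutativeSemiring
  open MonicPolynomials commutativeRing
  open Orders commutativeSemiring
  open SetoidReasoning setoid

  ⁻¹-inverseˡ : ∀ {x} → x ≉ 0# → x ⁻¹ * x ≈ 1#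
  ⁻¹-inverseˡ {x} x≉0 with x ≟ 0#
  ... | yes x≈0 = contradiction x≈0 x≉0
  ... | no  x≉0 = proj₁ (proj₂ (invertible x≉0))

  ⁻¹-inverseʳ : ∀ {x} → x ≉ 0# → x * x ⁻¹ ≈ 1#
  ⁻¹-inverseʳ x≉0 = trans (*-comm _ _) (⁻¹-inverseˡ x≉0)

  ⁻¹-zero : ∀ {x} → x ≈ 0# → x ⁻¹ ≈ 0#
  ⁻¹-zero {x} x≈0 with x ≟ 0#
  ... | yes _   = refl
  ... | no  x≉0 = contradiction x≈0 x≉0

  *-cancelˡ : ∀ {x y z} → x ≉ 0# → x * y ≈ x * z → y ≈ z
  *-cancelˡ {x} {y} {z} x≉0 xy≈xz = begin
    y                  ≈⟨ *-identityˡ y ⟨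
    1# * y             ≈⟨ *-congʳ (⁻¹-inverseˡ x≉0) ⟨
    (x ⁻¹ * x) * y     ≈⟨ *-assoc _ _ _ ⟩
    x ⁻¹ * (x * y)     ≈⟨ *-congˡ xy≈xz ⟩
    x ⁻¹ * (x * z)     ≈⟨ *-assoc _ _ _ ⟨
    (x ⁻¹ * x) * z     ≈⟨ *-congʳ (⁻¹-inverseˡ x≉0) ⟩
    1# * z             ≈⟨ *-identityˡ z ⟩
    z                  ∎

  x*y≈0⇒y≈0 : ∀ {x y} → x ≉ 0# → x * y ≈ 0# → y ≈ 0#
  x*y≈0⇒y≈0 x≉0 xy≈0 = *-cancelˡ x≉0 (trans xy≈0 (sym (zeroʳ _)))

  x*y≉0 : ∀ {x y} → x ≉ 0# → y ≉ 0# → x * y ≉ 0#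
  x*y≉0 x≉0 y≉0 xy≈0 = y≉0 (x*y≈0⇒y≈0 x≉0 xy≈0)

  x*y≈1⇒x≉0 : ∀ {x y} → x * y ≈ 1# → x ≉ 0#
  x*y≈1⇒x≉0 xy≈1 x≈0 = 1≉0 (trans (sym xy≈1) (trans (*-congʳ x≈0) (zeroˡ _)))

  ⁻¹-unique : ∀ {x y} → x * y ≈ 1# → x ⁻¹ ≈ y
  ⁻¹-unique xy≈1 = *-cancelˡ x≉0 (trans (⁻¹-inverseʳ x≉0) (sym xy≈1))
    where x≉0 = x*y≈1⇒x≉0 xy≈1

  ⁻¹-cong : ∀ {x y} → x ≈ y → x ⁻¹ ≈ y ⁻¹
  ⁻¹-cong {x} {y} x≈y with y ≟ 0#
  ... | yes y≈0 = ⁻¹-zero (trans x≈y y≈0)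
  ... | no  y≉0 = ⁻¹-unique (trans (*-congʳ x≈y) (proj₂ (proj₂ (invertible y≉0))))

  x⁻¹≉0 : ∀ {x} → x ≉ 0# → x ⁻¹ ≉ 0#
  x⁻¹≉0 x≉0 = x*y≈1⇒x≉0 (⁻¹-inverseˡ x≉0)

  -- The junk value keeps this true at `0#`, which makes inversion a bijection of the whole field
  -- and so a change of variables in sums.
  ⁻¹-involutive : ∀ x → x ⁻¹ ⁻¹ ≈ x
  ⁻¹-involutive x with x ≟ 0#
  ... | yes x≈0 = trans (⁻¹-zero refl) (sym x≈0)
  ... | no  x≉0 = ⁻¹-unique (proj₁ (proj₂ (invertible x≉0)))

  x^n≉0 : ∀ {x} n → x ≉ 0# → x ^ n ≉ 0#
  x^n≉0 zero    x≉0 = 1≉0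
  x^n≉0 (suc n) x≉0 = x*y≉0 x≉0 (x^n≉0 n x≉0)

  x-y≉0 : ∀ {x y} → x ≉ y → x - y ≉ 0#
  x-y≉0 {x} {y} x≉y x-y≈0 = x≉y (x∙y⁻¹≈ε⇒x≈y x y x-y≈0)

  y+[x-y]≈x : ∀ x y → y + (x - y) ≈ x
  y+[x-y]≈x x y = trans (+-comm _ _) (//-rightDividesˡ y x)

  Distinct : ∀ {k} → (Fin k → Carrier) → Set ℓ
  Distinct f = ∀ {i j} → f i ≈ f j → i ≡ j

  -- Induction by dividing out the root `r₀`: every other root differs from `r₀` by a unit and is
  -- therefore a root of the quotient. A monic polynomial of degree 0 is the constant 1 and has no
  -- root.
  roots≤degree : ∀ {k n} (as : Vec Carrier n) (r : Fin k → Carrier) → Distinct r →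
                 (∀ i → eval as (r i) ≈ 0#) → k ℕ.≤ n
  roots≤degree {zero}  as       r distinct root = ℕ.z≤n
  roots≤degree {suc k} []       r distinct root = contradiction (root Fin.zero) 1≉0
  roots≤degree {suc k} as@(_ ∷ _) r distinct root =
    ℕ.s≤s (roots≤degree (quotient as r₀) (r ∘ Fin.suc) (Fin.suc-injective ∘ distinct) quotient-root)
    where
    r₀ = r Fin.zero
    quotient-root : ∀ i → eval (quotient as r₀) (r (Fin.suc i)) ≈ 0#
    quotient-root i = x*y≈0⇒y≈0 (x-y≉0 λ eq → Fin.0≢1+n (≡.sym (distinct eq))) (+-identityʳ-unique (eval as r₀) _ (begin
      eval as r₀ + d * eval (quotient as r₀) rᵢ         ≈⟨ +-congˡ (*-congˡ (eval-cong (quotient as r₀) (y+[x-y]≈x rᵢ r₀))) ⟨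
      eval as r₀ + d * eval (quotient as r₀) (r₀ + d)   ≈⟨ eval-+ as r₀ d ⟨
      eval as (r₀ + d)                                  ≈⟨ eval-cong as (y+[x-y]≈x rᵢ r₀) ⟩
      eval as rᵢ                                        ≈⟨ root (Fin.suc i) ⟩
      0#                                                ≈⟨ root Fin.zero ⟨
      eval as r₀                                        ∎))
      where
      rᵢ = r (Fin.suc i)
      d = rᵢ - r₀

  element-injective : Distinct element
  element-injective = Injection.injective (Inverse⇒Injection enumeration)

  element-index : ∀ x → element (index x) ≈ x
  element-index = Inverse.strictlyInverseˡ enumeration

  index-injective : ∀ {x y} → index x ≡ index y → x ≈ y
  index-injective {x} {y} eq = begin
    x                  ≈⟨ element-index x ⟨
    element (index x)  ≡⟨ ≡.cong element eq ⟩
    element (index y)  ≈⟨ element-index y ⟩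
    y                  ∎

  distinct⇒≤ : ∀ {k} (f : Fin k → Carrier) → Distinct f → k ℕ.≤ q
  distinct⇒≤ f distinct = Fin.injective⇒≤ {f = index ∘ f} (distinct ∘ index-injective)

  ∷-distinct : ∀ {k x} (f : Fin k → Carrier) → (∀ i → x ≉ f i) → Distinct f → Distinct (x Vector.∷ f)
  ∷-distinct f x∉f distinct {Fin.zero}  {Fin.zero}  _  = ≡.refl
  ∷-distinct f x∉f distinct {Fin.zero}  {Fin.suc j} eq = contradiction eq (x∉f j)
  ∷-distinct f x∉f distinct {Fin.suc i} {Fin.zero}  eq = contradiction (sym eq) (x∉f i)
  ∷-distinct f x∉f distinct {Fin.suc i} {Fin.suc j} eq = ≡.cong Fin.suc (distinct eq)

  q≡suc[q-1] : q ≡ suc (q ∸ 1)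
  q≡suc[q-1] = helper q q-1-nonZero
    where
    helper : ∀ q → NonZero (q ∸ 1) → q ≡ suc (q ∸ 1)
    helper (suc q) _ = ≡.refl

  -- Represents X ^ suc n - 1: the `suc n` listed coefficients lie below an implicit leading one.
  x^n-1 : ∀ n → Vec Carrier (suc n)
  x^n-1 n = - 1# ∷ Vec.replicate n 0#

  eval-replicate : ∀ n x → eval (Vec.replicate n 0#) x ≈ x ^ n
  eval-replicate zero    x = refl
  eval-replicate (suc n) x = trans (+-identityʳ _) (*-congˡ (eval-replicate n x))

  -- Otherwise all elements of the field are roots of X ^ (2 + n) - X.
  ∃x^n≉1 : ∀ n → suc n ℕ.< q ∸ 1 → ∃ λ x → x ≉ 0# × x ^ suc n ≉ 1#
  ∃x^n≉1 n 1+n<q-1 with Fin.all? (λ i → (element i ≟ 0#) ⊎-dec ((element i ^ suc n) ≟ 1#))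
  ... | yes all = contradiction
        (ℕ.≤-<-trans (roots≤degree (0# ∷ x^n-1 n) element element-injective root)
                     (≡.subst (suc (suc n) ℕ.<_) (≡.sym q≡suc[q-1]) (ℕ.s<s 1+n<q-1)))
        (ℕ.<-irrefl ≡.refl)
    where
    root : ∀ i → eval (0# ∷ x^n-1 n) (element i) ≈ 0#
    root i = trans (+-identityʳ _) (case (all i))
      where
      x = element i
      case : x ≈ 0# ⊎ x ^ suc n ≈ 1# → x * eval (x^n-1 n) x ≈ 0#
      case (inj₁ x≈0)   = trans (*-congʳ x≈0) (zeroˡ _)
      case (inj₂ x^n≈1) = begin
        x * (x * eval (Vec.replicate n 0#) x - 1#)  ≈⟨ *-congˡ (+-congʳ (trans (*-congˡ (eval-replicate n x)) x^n≈1)) ⟩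
        x * (1# - 1#)                               ≈⟨ *-congˡ (-‿inverseʳ 1#) ⟩
        x * 0#                                      ≈⟨ zeroʳ x ⟩
        0#                                          ∎
  ... | no ¬all with Fin.¬∀⟶∃¬ q _ (λ i → (element i ≟ 0#) ⊎-dec ((element i ^ suc n) ≟ 1#)) ¬all
  ...   | i , ¬root = element i , ¬root ∘ inj₁ , ¬root ∘ inj₂

  x^i≈x^j⇒x^[j∸i]≈1 : ∀ {x i j} → x ≉ 0# → i ℕ.≤ j → x ^ i ≈ x ^ j → x ^ (j ∸ i) ≈ 1#
  x^i≈x^j⇒x^[j∸i]≈1 {x} {i} {j} x≉0 i≤j x^i≈x^j = *-cancelˡ (x^n≉0 i x≉0) (begin
    x ^ i * x ^ (j ∸ i)   ≈⟨ ^-homo-* x i (j ∸ i) ⟨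
    x ^ (i ℕ.+ (j ∸ i))   ≈⟨ ^-congʳ x (ℕ.m+[n∸m]≡n i≤j) ⟩
    x ^ j                 ≈⟨ x^i≈x^j ⟨
    x ^ i                 ≈⟨ *-identityʳ _ ⟨
    x ^ i * 1#            ∎)

  -- Among the first q + 1 powers two coincide, and the difference of their exponents sends `x` to
  -- 1.
  finite-order : ∀ {x} → x ≉ 0# → ∃ λ n → HasOrder x n
  finite-order {x} x≉0 with Fin.pigeonhole (ℕ.n<1+n q) (λ i → index (x ^ Fin.toℕ i))
  ... | i , j , i<j , eq = order-exists _≟_ x (Fin.toℕ j ∸ Fin.toℕ i) {{ℕ.>-nonZero (ℕ.m<n⇒0<n∸m i<j)}}
    (x^i≈x^j⇒x^[j∸i]≈1 x≉0 (ℕ.<⇒≤ i<j) (index-injective eq))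

  order⇒≉0 : ∀ {x n} → HasOrder x n → x ≉ 0#
  order⇒≉0 {n = suc n} o = x*y≈1⇒x≉0 (HasOrder.x^n≈1 o)
  order⇒≉0 {n = zero}  o = contradiction ≡.refl (ℕ.≢-nonZero⁻¹ 0 {{HasOrder.order≢0 o}})

  powers : ∀ n → Carrier → Fin n → Carrier
  powers n x i = x ^ Fin.toℕ i

  powers-distinct : ∀ {x n} → HasOrder x n → Distinct (powers n x)
  powers-distinct {x} {n} x-order = helper
    where
    distinct : ∀ {i j : Fin n} → i Fin.< j → powers n x i ≉ powers n x j
    distinct {i} {j} i<j eq = ∣.>⇒∤ {{ℕ.>-nonZero (ℕ.m<n⇒0<n∸m i<j)}}
      (ℕ.≤-<-trans (ℕ.m∸n≤m (Fin.toℕ j) (Fin.toℕ i)) (Fin.toℕ<n j))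
      (HasOrder.x^k≈1⇒n∣k x-order _ (x^i≈x^j⇒x^[j∸i]≈1 (order⇒≉0 x-order) (ℕ.<⇒≤ i<j) eq))
    helper : ∀ {i j} → powers n x i ≈ powers n x j → i ≡ j
    helper {i} {j} eq with Fin.<-cmp i j
    ... | tri< i<j _ _ = contradiction eq (distinct i<j)
    ... | tri≈ _ i≡j _ = i≡j
    ... | tri> _ _ j<i = contradiction (sym eq) (distinct j<i)

  0∉powers : ∀ {x n} → x ≉ 0# → ∀ i → 0# ≉ powers n x i
  0∉powers x≉0 i 0≈x^i = x^n≉0 (Fin.toℕ i) x≉0 (sym 0≈x^i)

  -- The powers of `x` below its order and `0#` are `suc n` distinct elements of the field.
  order≤q-1 : ∀ {x n} → HasOrder x n → n ℕ.≤ q ∸ 1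
  order≤q-1 {x} {n} x-order = ℕ.s≤s⁻¹ (≡.subst (suc n ℕ.≤_) q≡suc[q-1]
    (distinct⇒≤ _ (∷-distinct _ (0∉powers (order⇒≉0 x-order)) (powers-distinct x-order))))

  m∤n : ∀ {x m n} → HasOrder x m → x ^ n ≉ 1# → m ∤ n
  m∤n {x} {m} x-order x^n≉1 (divides k n≡k*m) = x^n≉1 (trans (^-congʳ x (≡.trans n≡k*m (ℕ.*-comm k m)))
    (x^n≈1⇒x^[n*k]≈1 m k (HasOrder.x^n≈1 x-order)))

  ∃larger-order : ∀ {x n} → HasOrder x n → n ≢ q ∸ 1 → ∃₂ λ y k → n ℕ.< k × HasOrder y k
  ∃larger-order {n = zero}  x-order n≢q-1 = contradiction ≡.refl (ℕ.≢-nonZero⁻¹ 0 {{HasOrder.order≢0 x-order}})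
  ∃larger-order {n = suc n} x-order n≢q-1 with ∃x^n≉1 n (ℕ.≤∧≢⇒< (order≤q-1 x-order) n≢q-1)
  ... | y , y≉0 , y^n≉1 with finite-order y≉0
  ...   | m , y-order = larger-order y-order x-order (m∤n y-order y^n≉1)

  generator : ∃ λ g → HasOrder g (q ∸ 1)
  generator = ascend (q ∸ 1) 1 1# (ℕ.n≤1+n (q ∸ 1)) 1-order
    where
    1-order : HasOrder 1# 1
    1-order = record { order≢0 = _ ; x^n≈1 = *-identityˡ 1# ; x^k≈1⇒n∣k = λ k _ → ∣.1∣ k }

    -- `d` is fuel. The order `n` grows by at least one whenever `d` drops by one, which preserves
    -- the bound; at `d = 0` the bound and `order≤q-1` leave only n = q - 1.
    ascend : ∀ d n x → q ∸ 1 ℕ.≤ n ℕ.+ d → HasOrder x n → ∃ λ g → HasOrder g (q ∸ 1)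
    ascend d n x bound x-order with n ℕ.≟ q ∸ 1
    ascend d n x bound x-order | yes n≡q-1 = x , ≡.subst (HasOrder x) n≡q-1 x-order
    ascend zero n x bound x-order | no n≢q-1 =
      contradiction (ℕ.≤-antisym (order≤q-1 x-order) (≡.subst (q ∸ 1 ℕ.≤_) (ℕ.+-identityʳ n) bound)) n≢q-1
    ascend (suc d) n x bound x-order | no n≢q-1 with ∃larger-order x-order n≢q-1
    ... | y , k , n<k , y-order = ascend d k y
      (ℕ.≤-trans bound (≡.subst (ℕ._≤ k ℕ.+ d) (≡.sym (ℕ.+-suc n d)) (ℕ.+-monoˡ-≤ d n<k))) y-order

  -- Otherwise `0#`, `x` and the q - 1 powers of `g` would be q + 1 distinct elements.
  discrete-log : ∀ {g x} → HasOrder g (q ∸ 1) → x ≉ 0# → ∃ λ i → powers (q ∸ 1) g i ≈ x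
  discrete-log {g} {x} g-order x≉0 with Fin.any? (λ i → powers (q ∸ 1) g i ≟ x)
  ... | yes log = log
  ... | no ¬log = contradiction
    (≡.subst (2 ℕ.+ (q ∸ 1) ℕ.≤_) q≡suc[q-1] (distinct⇒≤ _ (∷-distinct _ 0∉
      (∷-distinct _ (λ i x≈g^i → ¬log (i , sym x≈g^i)) (powers-distinct g-order)))))
    (ℕ.<-irrefl ≡.refl)
    where
    0∉ : ∀ i → 0# ≉ (x Vector.∷ powers (q ∸ 1) g) i
    0∉ Fin.zero    0≈x = x≉0 (sym 0≈x)
    0∉ (Fin.suc i)     = 0∉powers (order⇒≉0 g-order) i

-- Sums over enumerated setoids.

module EnumeratedSums {c ℓ} (R : CommutativeRing c ℓ) where
  open CommutativeRing R
  open Sum semiring using (sum; sum-cong-≋; sum-remove; sum-permute; sum-replicate-zero)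
  open SetoidReasoning setoid

  sum-single : ∀ {n} (f : Fin n → Carrier) i → (∀ j → j ≢ i → f j ≈ 0#) → sum f ≈ f i
  sum-single {suc n} f i f≈0 = begin
    sum f                              ≈⟨ sum-remove {i = i} f ⟩
    f i + sum (Vector.removeAt f i)    ≈⟨ +-congˡ (trans (sum-cong-≋ (λ j → f≈0 _ (Fin.punchInᵢ≢i i j))) (sum-replicate-zero n)) ⟩
    f i + 0#                           ≈⟨ +-identityʳ _ ⟩
    f i                                ∎

  -- Two enumerations of `S` differ by a permutation of indices. All changes of variables below are
  -- instances, since an enumeration followed by a bijection of `S` is again an enumeration.
  sum-enumeration : ∀ {a b m n} {S : Setoid a b} (E₁ : Enumeration m S) (E₂ : Enumeration n S) →
                    (f : Setoid.Carrier S → Carrier) → (∀ {x y} → Setoid._≈_ S x y → f x ≈ f y) →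
                    sum (f ∘ Inverse.to E₁) ≈ sum (f ∘ Inverse.to E₂)
  sum-enumeration {S = S} E₁ E₂ f f-cong =
    trans (sum-permute (f ∘ Inverse.to E₁) π) (sum-cong-≋ λ i → f-cong (Inverse.strictlyInverseˡ E₁ (Inverse.to E₂ i)))
    where
    π : Permutation _ _
    π = Composition.inverse E₂ (Symmetry.inverse E₁)

-- Values of characters, sums over the field and orthogonality.

module CharacterProperties {q c ℓ k ℓ₁ ℓ₂} (𝔽 : FiniteField q c ℓ) (K : HeytingField k ℓ₁ ℓ₂) where
  open Characters 𝔽 K
  open CommutativeRing commutativeRing using (semiring; commutativeSemiring; ring)
  open HeytingProperties heytingCommutativeRing using (1#0; x#0y#0→xy#0; invertibleʳ⇒#; x-0≈x; #-congʳ)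
  open RingProperties ring using (+-cancelʳ; //-rightDividesˡ; x≈y⇒x∙y⁻¹≈ε)
  open Sum semiring using (sum-cong-≋; sum-replicate; sum-replicate-zero; ∑-distrib-+; ∑-comm; *-distribˡ-sum; *-distribʳ-sum)
  open EnumeratedSums commutativeRing
  module FP = FiniteFieldProperties 𝔽
  open SetoidReasoning setoid

  #0-*-cancelˡ : ∀ {x y z} → x # 0# → x * y ≈ x * z → y ≈ z
  #0-*-cancelˡ {x} {y} {z} x#0 xy≈xz = begin
    y                      ≈⟨ *-identityˡ y ⟨
    1# * y                 ≈⟨ *-congʳ (recip-inverseˡ x#0) ⟨
    recip x#0 * x * y      ≈⟨ *-assoc _ _ _ ⟩
    recip x#0 * (x * y)    ≈⟨ *-congˡ xy≈xz ⟩
    recip x#0 * (x * z)    ≈⟨ *-assoc _ _ _ ⟨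
    recip x#0 * x * z      ≈⟨ *-congʳ (recip-inverseˡ x#0) ⟩
    1# * z                 ≈⟨ *-identityˡ z ⟩
    z                      ∎

  -- Only the negation of `c ≈ 1#` is available, so `c - 1` cannot be inverted. By tightness it
  -- suffices to refute `x # 0#`, and then `x` can be cancelled.
  cx≈x⇒x≈0 : ∀ {c x} → ¬ c ≈ 1# → c * x ≈ x → x ≈ 0#
  cx≈x⇒x≈0 {c} {x} c≉1 cx≈x = proj₁ (tight x 0#) λ x#0 →
    c≉1 (#0-*-cancelˡ x#0 (trans (*-comm x c) (trans cx≈x (sym (*-identityʳ x)))))

  module _ (χ : Character) where
    open Character χ using (cong; nonzero; homo; at-zero)

    χ-zero : ∀ {x} → x F.≈ F.0# → χ ⟨ x ⟩ ≈ 0#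
    χ-zero x≈0 = trans (cong x≈0) at-zero

    χ-one : χ ⟨ F.1# ⟩ ≈ 1#
    χ-one = #0-*-cancelˡ (nonzero F.1≉0) (begin
      χ ⟨ F.1# ⟩ * χ ⟨ F.1# ⟩  ≈⟨ homo F.1≉0 F.1≉0 ⟨
      χ ⟨ F.1# F.* F.1# ⟩      ≈⟨ cong (F.*-identityˡ F.1#) ⟩
      χ ⟨ F.1# ⟩               ≈⟨ *-identityʳ _ ⟨
      χ ⟨ F.1# ⟩ * 1#          ∎)

    χ-* : ∀ x y → χ ⟨ x F.* y ⟩ ≈ χ ⟨ x ⟩ * χ ⟨ y ⟩
    χ-* x y with x F.≟ F.0# | y F.≟ F.0#
    ... | yes x≈0 | _       = trans (χ-zero (F.trans (F.*-congʳ x≈0) (F.zeroˡ y)))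
                                    (sym (trans (*-congʳ (χ-zero x≈0)) (zeroˡ _)))
    ... | no  _   | yes y≈0 = trans (χ-zero (F.trans (F.*-congˡ y≈0) (F.zeroʳ x)))
                                    (sym (trans (*-congˡ (χ-zero y≈0)) (zeroʳ _)))
    ... | no x≉0  | no y≉0  = homo x≉0 y≉0

    χ⁻¹-* : ∀ {x} → x F.≉ F.0# → χ ⁻¹ ⟨ x ⟩ * χ ⟨ x ⟩ ≈ 1#
    χ⁻¹-* {x} x≉0 with x F.≟ F.0#
    ... | yes x≈0 = contradiction x≈0 x≉0
    ... | no _    = recip-inverseˡ _

    -- At `0#` both sides vanish because of the junk inverse. Inverse characters can thus be traded
    -- for inverse arguments everywhere, and multiplicativity does the rest.
    χ⁻¹-value : ∀ x → χ ⁻¹ ⟨ x ⟩ ≈ χ ⟨ x F.⁻¹ ⟩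
    χ⁻¹-value x = helper (x F.≟ F.0#)
      where
      helper : Dec (x F.≈ F.0#) → χ ⁻¹ ⟨ x ⟩ ≈ χ ⟨ x F.⁻¹ ⟩
      helper (yes x≈0) = trans (trans (Character.cong (χ ⁻¹) x≈0) (Character.at-zero (χ ⁻¹))) (sym (χ-zero (FP.⁻¹-zero x≈0)))
      helper (no  x≉0) = inverse-unique (χ⁻¹-* x≉0) (trans (sym (χ-* _ x)) (trans (cong (FP.⁻¹-inverseˡ x≉0)) χ-one))

  ε-one : ∀ {x} → x F.≉ F.0# → ε ⟨ x ⟩ ≈ 1#
  ε-one {x} x≉0 with x F.≟ F.0#
  ... | yes x≈0 = contradiction x≈0 x≉0
  ... | no  _   = refl

  ε-* : ∀ χ x → ε ⟨ x ⟩ * χ ⟨ x ⟩ ≈ χ ⟨ x ⟩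
  ε-* χ x with x F.≟ F.0#
  ... | yes x≈0 = trans (zeroˡ _) (sym (χ-zero χ x≈0))
  ... | no  _   = *-identityˡ _

  χ⁻¹*χ≈ε : ∀ χ x → χ ⁻¹ ⟨ x ⟩ * χ ⟨ x ⟩ ≈ ε ⟨ x ⟩
  χ⁻¹*χ≈ε χ x with x F.≟ F.0#
  ... | yes _   = zeroˡ _
  ... | no  x≉0 = recip-inverseˡ _

  ε⁻¹≈ε : ∀ x → ε ⁻¹ ⟨ x ⟩ ≈ ε ⟨ x ⟩
  ε⁻¹≈ε x = begin
    ε ⁻¹ ⟨ x ⟩              ≈⟨ ε-* (ε ⁻¹) x ⟨
    ε ⟨ x ⟩ * ε ⁻¹ ⟨ x ⟩    ≈⟨ *-comm _ _ ⟩
    ε ⁻¹ ⟨ x ⟩ * ε ⟨ x ⟩    ≈⟨ χ⁻¹*χ≈ε ε x ⟩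
    ε ⟨ x ⟩                 ∎

  ∑𝔽-cong : ∀ {f g : F.Carrier → Carrier} → (∀ x → f x ≈ g x) → ∑𝔽 f ≈ ∑𝔽 g
  ∑𝔽-cong f≈g = sum-cong-≋ (λ i → f≈g (F.element i))

  ∑𝔽-*ˡ : ∀ a (f : F.Carrier → Carrier) → a * ∑𝔽 f ≈ ∑𝔽[ x ] (a * f x)
  ∑𝔽-*ˡ a f = *-distribˡ-sum a (f ∘ F.element)

  ∑𝔽-*ʳ : ∀ (f : F.Carrier → Carrier) a → ∑𝔽 f * a ≈ ∑𝔽[ x ] (f x * a)
  ∑𝔽-*ʳ f a = *-distribʳ-sum a (f ∘ F.element)

  ∑𝔽-+ : ∀ (f g : F.Carrier → Carrier) → ∑𝔽[ x ] (f x + g x) ≈ ∑𝔽 f + ∑𝔽 g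
  ∑𝔽-+ f g = ∑-distrib-+ (f ∘ F.element) (g ∘ F.element)

  ∑𝔽-reindex : (φ : Inverse F.setoid F.setoid) (f : F.Carrier → Carrier) →
               (∀ {x y} → x F.≈ y → f x ≈ f y) → ∑𝔽 f ≈ ∑𝔽 (f ∘ Inverse.to φ)
  ∑𝔽-reindex φ f f-cong = sum-enumeration F.enumeration (Composition.inverse F.enumeration φ) f f-cong

  ∑𝔽-single : ∀ {f : F.Carrier → Carrier} a → (∀ {x y} → x F.≈ y → f x ≈ f y) →
              (∀ x → x F.≉ a → f x ≈ 0#) → ∑𝔽 f ≈ f a
  ∑𝔽-single {f} a f-cong f≈0 = trans
    (sum-single (f ∘ F.element) (F.index a) λ j j≢ → f≈0 _ λ eq →
      j≢ (≡.trans (≡.sym (Inverse.strictlyInverseʳ F.enumeration j)) (Inverse.from-cong F.enumeration eq)))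
    (f-cong (FP.element-index a))

  ∑𝔽-zero : ∀ {f : F.Carrier → Carrier} → (∀ x → f x ≈ 0#) → ∑𝔽 f ≈ 0#
  ∑𝔽-zero f≈0 = trans (∑𝔽-cong f≈0) (sum-replicate-zero q)

  scaling : ∀ {b} → b F.≉ F.0# → Inverse F.setoid F.setoid
  scaling {b} b≉0 = record
    { to        = b F.*_
    ; from      = b F.⁻¹ F.*_
    ; to-cong   = F.*-congˡ
    ; from-cong = F.*-congˡ
    ; inverse   = (λ {x} y≈ → F.trans (F.*-congˡ y≈) (cancel (FP.⁻¹-inverseʳ b≉0) x))
                , (λ {x} y≈ → F.trans (F.*-congˡ y≈) (cancel (FP.⁻¹-inverseˡ b≉0) x))
    }
    where
    cancel : ∀ {a b} → a F.* b F.≈ F.1# → ∀ x → a F.* (b F.* x) F.≈ x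
    cancel ab≈1 x = F.trans (F.sym (F.*-assoc _ _ x)) (F.trans (F.*-congʳ ab≈1) (F.*-identityˡ x))

  translation : Character → Inverse characterSetoid characterSetoid
  translation χ = record
    { to        = χ ∙_
    ; from      = χ ⁻¹ ∙_
    ; to-cong   = λ eq x → *-congˡ (eq x)
    ; from-cong = λ eq x → *-congˡ (eq x)
    ; inverse   = (λ {θ} eq x → trans (*-congˡ (eq x)) (cancel θ x (trans (*-comm _ _) (χ⁻¹*χ≈ε χ x))))
                , (λ {θ} eq x → trans (*-congˡ (eq x)) (cancel θ x (χ⁻¹*χ≈ε χ x)))
    }
    where
    cancel : ∀ θ x {a b} → a * b ≈ ε ⟨ x ⟩ → a * (b * θ ⟨ x ⟩) ≈ θ ⟨ x ⟩
    cancel θ x ab≈ε = trans (sym (*-assoc _ _ _)) (trans (*-congʳ ab≈ε) (ε-* θ x))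

  -- Scaling the variable by b ≠ 0 multiplies the sum by θ(b) and also preserves it. If the sum were
  -- apart from 0, then θ(b) = 1 for every such b, so θ would be trivial. No particular b with θ(b)
  -- ≠ 1 has to be found.
  ∑-nontrivial-character : ∀ θ → ¬ (∀ x → θ ⟨ x ⟩ ≈ ε ⟨ x ⟩) → ∑𝔽[ x ] (θ ⟨ x ⟩) ≈ 0#
  ∑-nontrivial-character θ θ≉ε = proj₁ (tight _ _) λ ∑#0 → θ≉ε λ x → helper ∑#0 x (x F.≟ F.0#)
    where
    invariant : ∀ {b} → b F.≉ F.0# → θ ⟨ b ⟩ * ∑𝔽[ x ] (θ ⟨ x ⟩) ≈ ∑𝔽[ x ] (θ ⟨ x ⟩)
    invariant {b} b≉0 = begin
      θ ⟨ b ⟩ * ∑𝔽[ x ] (θ ⟨ x ⟩)      ≈⟨ ∑𝔽-*ˡ (θ ⟨ b ⟩) (θ ⟨_⟩) ⟩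
      ∑𝔽[ x ] (θ ⟨ b ⟩ * θ ⟨ x ⟩)      ≈⟨ ∑𝔽-cong (λ x → χ-* θ b x) ⟨
      ∑𝔽[ x ] (θ ⟨ b F.* x ⟩)          ≈⟨ ∑𝔽-reindex (scaling b≉0) (θ ⟨_⟩) (Character.cong θ) ⟨
      ∑𝔽[ x ] (θ ⟨ x ⟩)                ∎
    helper : ∑𝔽[ x ] (θ ⟨ x ⟩) # 0# → ∀ x → Dec (x F.≈ F.0#) → θ ⟨ x ⟩ ≈ ε ⟨ x ⟩
    helper ∑#0 x (yes x≈0) = trans (χ-zero θ x≈0) (sym (χ-zero ε x≈0))
    helper ∑#0 x (no  x≉0) = trans
      (#0-*-cancelˡ ∑#0 (trans (*-comm _ _) (trans (invariant x≉0) (sym (*-identityʳ _))))) (sym (ε-one x≉0))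

  -- The indicator function of `0#`.
  1-ε : F.Carrier → Carrier
  1-ε x = 1# - ε ⟨ x ⟩

  1-ε-cong : ∀ {x y} → x F.≈ y → 1-ε x ≈ 1-ε y
  1-ε-cong x≈y = +-congˡ (-‿cong (Character.cong ε x≈y))

  1-ε-zero : ∀ {x} → x F.≈ F.0# → 1-ε x ≈ 1#
  1-ε-zero x≈0 = trans (+-congˡ (-‿cong (χ-zero ε x≈0))) (x-0≈x 1#)

  1-ε-nonzero : ∀ {x} → x F.≉ F.0# → 1-ε x ≈ 0#
  1-ε-nonzero x≉0 = x≈y⇒x∙y⁻¹≈ε (sym (ε-one x≉0))

  -- Adding the indicator of `0#`, whose sum is 1, turns ε into the constant 1, whose sum is q.
  ∑-ε : ∑𝔽[ x ] (ε ⟨ x ⟩) ≈ (q ∸ 1) · 1#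
  ∑-ε = +-cancelʳ 1# _ _ (begin
    ∑𝔽[ x ] (ε ⟨ x ⟩) + 1#                  ≈⟨ +-congˡ (1-ε-zero F.refl) ⟨
    ∑𝔽[ x ] (ε ⟨ x ⟩) + 1-ε F.0#            ≈⟨ +-congˡ (∑𝔽-single F.0# 1-ε-cong (λ _ → 1-ε-nonzero)) ⟨
    ∑𝔽[ x ] (ε ⟨ x ⟩) + ∑𝔽[ x ] (1-ε x)     ≈⟨ ∑𝔽-+ (ε ⟨_⟩) 1-ε ⟨
    ∑𝔽[ x ] (ε ⟨ x ⟩ + 1-ε x)               ≈⟨ ∑𝔽-cong (λ x → trans (+-comm _ _) (//-rightDividesˡ (ε ⟨ x ⟩) 1#)) ⟩
    ∑𝔽[ x ] 1#                              ≈⟨ sum-replicate q ⟩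
    q · 1#                                  ≡⟨ ≡.cong (_· 1#) FP.q≡suc[q-1] ⟩
    1# + (q ∸ 1) · 1#                       ≈⟨ +-comm _ _ ⟩
    (q ∸ 1) · 1# + 1#                       ∎)

  -- A character separating points, and orthogonality over the characters.

  module Separation (ζ : Carrier) (ζ-primitive : IsPrimitiveRoot (q ∸ 1) ζ) where
    open Exponentiation commutativeSemiring using (^-homo-*; ^-congʳ)
    open Orders commutativeSemiring using (x^n≈1⇒x^[n*k]≈1)
    module FE = Exponentiation F.commutativeSemiring
    open Orders F.commutativeSemiring using (HasOrder)

    private
      g : F.Carrier
      g = proj₁ FP.generator

      g-order : HasOrder g (q ∸ 1)
      g-order = proj₂ FP.generator

      log : ∀ {x} → x F.≉ F.0# → ℕ
      log x≉0 = Fin.toℕ (proj₁ (FP.discrete-log g-order x≉0))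

      g^log : ∀ {x} (x≉0 : x F.≉ F.0#) → g FE.^ log x≉0 F.≈ x
      g^log x≉0 = proj₂ (FP.discrete-log g-order x≉0)

    ζ^-#0 : ∀ n → ζ ^ n # 0#
    ζ^-#0 zero    = 1#0
    ζ^-#0 (suc n) = x#0y#0→xy#0 (ζ#0 (q ∸ 1) F.q-1-nonZero (proj₁ ζ-primitive)) (ζ^-#0 n)
      where
      ζ#0 : ∀ n → NonZero n → ζ ^ n ≈ 1# → ζ # 0#
      ζ#0 (suc n) _ ζ^n≈1 = invertibleʳ⇒# (ζ ^ n , trans (*-congʳ (x-0≈x ζ)) ζ^n≈1)

    -- Equal powers of `g` have exponents congruent modulo q - 1, and ζ ^ (q - 1) = 1. The ordering
    -- of `i` and `j` makes the truncated difference `j ∸ i` the true one.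
    g^i≈g^j⇒ζ^i≈ζ^j-≤ : ∀ {i j} → i ℕ.≤ j → g FE.^ i F.≈ g FE.^ j → ζ ^ i ≈ ζ ^ j
    g^i≈g^j⇒ζ^i≈ζ^j-≤ {i} {j} i≤j eq
      with HasOrder.x^k≈1⇒n∣k g-order (j ∸ i) (FP.x^i≈x^j⇒x^[j∸i]≈1 (FP.order⇒≉0 g-order) i≤j eq)
    ... | divides k j∸i≡ = sym (begin
      ζ ^ j                          ≈⟨ ^-congʳ ζ (ℕ.m+[n∸m]≡n i≤j) ⟨
      ζ ^ (i ℕ.+ (j ∸ i))            ≈⟨ ^-homo-* ζ i (j ∸ i) ⟩
      ζ ^ i * ζ ^ (j ∸ i)            ≈⟨ *-congˡ (^-congʳ ζ (≡.trans j∸i≡ (ℕ.*-comm k (q ∸ 1)))) ⟩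
      ζ ^ i * ζ ^ ((q ∸ 1) ℕ.* k)    ≈⟨ *-congˡ (x^n≈1⇒x^[n*k]≈1 (q ∸ 1) k (proj₁ ζ-primitive)) ⟩
      ζ ^ i * 1#                     ≈⟨ *-identityʳ _ ⟩
      ζ ^ i                          ∎)

    g^i≈g^j⇒ζ^i≈ζ^j : ∀ {i j} → g FE.^ i F.≈ g FE.^ j → ζ ^ i ≈ ζ ^ j
    g^i≈g^j⇒ζ^i≈ζ^j {i} {j} g^i≈g^j with ℕ.≤-total i j
    ... | inj₁ i≤j = g^i≈g^j⇒ζ^i≈ζ^j-≤ {i} {j} i≤j g^i≈g^j
    ... | inj₂ j≤i = sym (g^i≈g^j⇒ζ^i≈ζ^j-≤ {j} {i} j≤i (F.sym g^i≈g^j))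

    ω-value : F.Carrier → Carrier
    ω-value x with x F.≟ F.0#
    ... | yes _   = 0#
    ... | no  x≉0 = ζ ^ log x≉0

    -- Any exponent of `g` representing `x` will do, not just the chosen logarithm. Multiplicativity
    -- of ω rests on this: the sum of two logarithms represents the product but may exceed its
    -- logarithm.
    ω-≈ζ^ : ∀ {x} i → g FE.^ i F.≈ x → ω-value x ≈ ζ ^ i
    ω-≈ζ^ {x} i g^i≈x with x F.≟ F.0#
    ... | yes x≈0 = contradiction (F.trans g^i≈x x≈0) (FP.x^n≉0 i (FP.order⇒≉0 g-order))
    ... | no  x≉0 = g^i≈g^j⇒ζ^i≈ζ^j {log x≉0} {i} (F.trans (g^log x≉0) (F.sym g^i≈x))

    ω-zero : ∀ {x} → x F.≈ F.0# → ω-value x ≈ 0#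
    ω-zero {x} x≈0 with x F.≟ F.0#
    ... | yes _   = refl
    ... | no  x≉0 = contradiction x≈0 x≉0

    ω : Character
    ω = record
      { _⟨_⟩    = ω-value
      ; cong    = λ {x} x≈y → ω-cong x≈y (x F.≟ F.0#)
      ; nonzero = λ x≉0 → #-congʳ (sym (ω-≈ζ^ (log x≉0) (g^log x≉0))) (ζ^-#0 (log x≉0))
      ; homo    = ω-homo
      ; at-zero = ω-zero F.refl
      }
      where
      ω-cong : ∀ {x y} → x F.≈ y → Dec (x F.≈ F.0#) → ω-value x ≈ ω-value y
      ω-cong x≈y (yes x≈0) = trans (ω-zero x≈0) (sym (ω-zero (F.trans (F.sym x≈y) x≈0)))
      ω-cong x≈y (no  x≉0) = trans (ω-≈ζ^ (log x≉0) (g^log x≉0)) (sym (ω-≈ζ^ (log x≉0) (F.trans (g^log x≉0) x≈y)))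

      ω-homo : ∀ {x y} → x F.≉ F.0# → y F.≉ F.0# → ω-value (x F.* y) ≈ ω-value x * ω-value y
      ω-homo {x} {y} x≉0 y≉0 = begin
        ω-value (x F.* y)                ≈⟨ ω-≈ζ^ (log x≉0 ℕ.+ log y≉0)
                                                (F.trans (FE.^-homo-* g (log x≉0) (log y≉0))
                                                         (F.*-cong (g^log x≉0) (g^log y≉0))) ⟩
        ζ ^ (log x≉0 ℕ.+ log y≉0)        ≈⟨ ^-homo-* ζ (log x≉0) (log y≉0) ⟩
        ζ ^ log x≉0 * ζ ^ log y≉0        ≈⟨ *-cong (ω-≈ζ^ (log x≉0) (g^log x≉0)) (ω-≈ζ^ (log y≉0) (g^log y≉0)) ⟨
        ω-value x * ω-value y            ∎

    -- As x ≠ 1, its logarithm lies strictly between 0 and q - 1, where primitivity keeps the power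
    -- of ζ apart from 1.
    ω-separates : ∀ {x} → x F.≉ F.0# → x F.≉ F.1# → ¬ ω ⟨ x ⟩ ≈ 1#
    ω-separates {x} x≉0 x≉1 ωx≈1 = helper (log x≉0) (Fin.toℕ<n (proj₁ (FP.discrete-log g-order x≉0))) (g^log x≉0)
      where
      helper : ∀ i → i ℕ.< q ∸ 1 → ¬ (g FE.^ i F.≈ x)
      helper zero    _     g^0≈x = x≉1 (F.sym g^0≈x)
      helper (suc i) i<q-1 g^i≈x = #-irrefl (trans (sym (ω-≈ζ^ (suc i) g^i≈x)) ωx≈1)
        (proj₂ ζ-primitive (suc i) ℕ.z<s i<q-1)

    module _ {m : ℕ} (characters : Enumeration m characterSetoid) where

      -- Multiplication by ω permutes the characters and multiplies the sum by ω(x), which is not 1.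
      ∑-characters-vanishes : ∀ {x} → x F.≉ F.1# → ∑[ θ ∈ characters ] (θ ⟨ x ⟩) ≈ 0#
      ∑-characters-vanishes {x} x≉1 = helper (x F.≟ F.0#)
        where
        helper : Dec (x F.≈ F.0#) → ∑[ θ ∈ characters ] (θ ⟨ x ⟩) ≈ 0#
        helper (yes x≈0) = trans (sum-cong-≋ (λ i → χ-zero (Inverse.to characters i) x≈0)) (sum-replicate-zero m)
        helper (no  x≉0) = cx≈x⇒x≈0 (ω-separates x≉0 x≉1) (begin
          ω ⟨ x ⟩ * ∑[ θ ∈ characters ] (θ ⟨ x ⟩)    ≈⟨ *-distribˡ-sum (ω ⟨ x ⟩) (λ i → Inverse.to characters i ⟨ x ⟩) ⟩
          ∑[ θ ∈ characters ] ((ω ∙ θ) ⟨ x ⟩)        ≈⟨ sum-enumeration characters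
                                                          (Composition.inverse characters (translation ω))
                                                          (_⟨ x ⟩) (λ eq → eq x) ⟨
          ∑[ θ ∈ characters ] (θ ⟨ x ⟩)              ∎)

      -- The sum of θ ⟨ x ⟩ over all pairs (θ , x) is evaluated in both orders.
      ∑-characters-one : ∑[ θ ∈ characters ] (θ ⟨ F.1# ⟩) ≈ (q ∸ 1) · 1#
      ∑-characters-one = begin
        ∑[ θ ∈ characters ] (θ ⟨ F.1# ⟩)               ≈⟨ ∑𝔽-single {λ x → ∑[ θ ∈ characters ] (θ ⟨ x ⟩)} F.1#
                                                            (λ x≈y → sum-cong-≋ (λ i → Character.cong (Inverse.to characters i) x≈y))
                                                            (λ _ → ∑-characters-vanishes) ⟨
        ∑𝔽[ x ] ∑[ θ ∈ characters ] (θ ⟨ x ⟩)          ≈⟨ ∑-comm (λ j i → Inverse.to characters i ⟨ F.element j ⟩) ⟩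
        ∑[ θ ∈ characters ] ∑𝔽[ x ] (θ ⟨ x ⟩)          ≈⟨ sum-single (λ i → ∑𝔽[ x ] (Inverse.to characters i ⟨ x ⟩))
                                                            (Inverse.from characters ε)
                                                            (λ j j≢ → ∑-nontrivial-character (Inverse.to characters j) λ eq →
                                                              j≢ (≡.trans (≡.sym (Inverse.strictlyInverseʳ characters j))
                                                                          (Inverse.from-cong characters eq))) ⟩
        ∑𝔽[ x ] (Inverse.to characters (Inverse.from characters ε) ⟨ x ⟩)
                                                       ≈⟨ ∑𝔽-cong (Inverse.strictlyInverseˡ characters ε) ⟩
        ∑𝔽[ x ] (ε ⟨ x ⟩)                              ≈⟨ ∑-ε ⟩
        (q ∸ 1) · 1#                                   ∎

-- Identities in the finite field: changes of variables and the arguments of the characters.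

module FieldIdentities {q c ℓ} (𝔽 : FiniteField q c ℓ) where
  open FiniteField 𝔽
  open FiniteFieldProperties 𝔽
  open RingProperties ring
  open CommutativeMonoidSolver *-commutativeMonoid
  private module + = CommutativeMonoidSolver +-commutativeMonoid
  open SetoidReasoning setoid

  private variable
    s t w x y : Carrier

  1-[1-x]≈x : ∀ x → 1# - (1# - x) ≈ x
  1-[1-x]≈x x = begin
    1# - (1# - x)   ≈⟨ +-congˡ (⁻¹-anti-homo-// 1# x) ⟩
    1# + (x - 1#)   ≈⟨ y+[x-y]≈x x 1# ⟩
    x               ∎

  reflection : Inverse setoid setoid
  reflection = record
    { to        = λ x → 1# - x
    ; from      = λ x → 1# - x
    ; to-cong   = λ x≈y → +-congˡ (-‿cong x≈y)
    ; from-cong = λ x≈y → +-congˡ (-‿cong x≈y)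
    ; inverse   = (λ {x} y≈ → trans (+-congˡ (-‿cong y≈)) (1-[1-x]≈x x))
                , (λ {x} y≈ → trans (+-congˡ (-‿cong y≈)) (1-[1-x]≈x x))
    }

  inversion : Inverse setoid setoid
  inversion = record
    { to        = _⁻¹
    ; from      = _⁻¹
    ; to-cong   = ⁻¹-cong
    ; from-cong = ⁻¹-cong
    ; inverse   = (λ {x} y≈ → trans (⁻¹-cong y≈) (⁻¹-involutive x))
                , (λ {x} y≈ → trans (⁻¹-cong y≈) (⁻¹-involutive x))
    }

  xy≈1⇒1-y≈-[1-x]y : x * y ≈ 1# → 1# - y ≈ - 1# * (1# - x) * y
  xy≈1⇒1-y≈-[1-x]y {x} {y} xy≈1 = begin
    1# - y                   ≈⟨ +-cong xy≈1 (-‿cong (*-identityˡ y)) ⟨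
    x * y - 1# * y           ≈⟨ [y-z]x≈yx-zx y x 1# ⟨
    (x - 1#) * y             ≈⟨ *-congʳ (trans (-1*x≈-x _) (⁻¹-anti-homo-// 1# x)) ⟨
    - 1# * (1# - x) * y      ∎

  -1≉0 : - 1# ≉ 0#
  -1≉0 -1≈0 = 1≉0 (trans (sym (-‿involutive 1#)) (trans (-‿cong -1≈0) -0#≈0#))

  -1*-1≈1 : - 1# * - 1# ≈ 1#
  -1*-1≈1 = trans (-1*x≈-x (- 1#)) (-‿involutive 1#)

  [1-w]s≈s-ws : ∀ w s → (1# - w) * s ≈ s - w * s
  [1-w]s≈s-ws w s = trans ([y-z]x≈yx-zx s 1# w) (+-congʳ (*-identityˡ s))

  -- The condition selected by orthogonality, solved for `w`. The solution w = s/(s - t) is kept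
  -- free of division because `s - t` may vanish.
  [1-w]s≈-wt⇒w[s-t]≈s : (1# - w) * s ≈ - 1# * w * t → w * (s - t) ≈ s
  [1-w]s≈-wt⇒w[s-t]≈s {w} {s} {t} eq = begin
    w * (s - t)                  ≈⟨ x[y-z]≈xy-xz w s t ⟩
    w * s - w * t                ≈⟨ +-comm _ _ ⟩
    - (w * t) + w * s            ≈⟨ +-congʳ (trans (*-assoc _ _ _) (-1*x≈-x (w * t))) ⟨
    - 1# * w * t + w * s         ≈⟨ +-congʳ eq ⟨
    (1# - w) * s + w * s         ≈⟨ +-congʳ ([1-w]s≈s-ws w s) ⟩
    s - w * s + w * s            ≈⟨ //-rightDividesˡ (w * s) s ⟩
    s                            ∎

  w[s-t]≈s⇒[1-w]s≈-wt : w * (s - t) ≈ s → (1# - w) * s ≈ - 1# * w * t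
  w[s-t]≈s⇒[1-w]s≈-wt {w} {s} {t} eq = begin
    (1# - w) * s                 ≈⟨ [1-w]s≈s-ws w s ⟩
    s - w * s                    ≈⟨ +-congʳ eq ⟨
    w * (s - t) - w * s          ≈⟨ x[y-z]≈xy-xz w (s - t) s ⟨
    w * (s - t - s)              ≈⟨ *-congˡ (xyx⁻¹≈y s (- t)) ⟩
    w * - t                      ≈⟨ -‿distribʳ-* w t ⟨
    - (w * t)                    ≈⟨ trans (*-assoc _ _ _) (-1*x≈-x (w * t)) ⟨
    - 1# * w * t                 ∎

  -- θ(ρ s t w) is the product θ(-1) θ(w) θ⁻¹(1 - w) θ⁻¹(s) θ(t).
  ρ : Carrier → Carrier → Carrier → Carrier
  ρ s t w = - 1# * w * (1# - w) ⁻¹ * s ⁻¹ * t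

  ρ-cong : ∀ {s t w w′} → w ≈ w′ → ρ s t w ≈ ρ s t w′
  ρ-cong w≈w′ = *-congʳ (*-congʳ (*-cong (*-congˡ w≈w′) (⁻¹-cong (+-congˡ (-‿cong w≈w′)))))

  ρ*≈-wt : 1# - w ≉ 0# → s ≉ 0# → ρ s t w * ((1# - w) * s) ≈ - 1# * w * t
  ρ*≈-wt {w} {s} {t} 1-w≉0 s≉0 = begin
    - 1# * w * (1# - w) ⁻¹ * s ⁻¹ * t * ((1# - w) * s)
      ≈⟨ solve 7 (λ m w i j t z s → ((((m ⊕ w) ⊕ i) ⊕ j) ⊕ t) ⊕ (z ⊕ s) ⊜ ((m ⊕ w) ⊕ t) ⊕ ((i ⊕ z) ⊕ (j ⊕ s)))
           refl (- 1#) w ((1# - w) ⁻¹) (s ⁻¹) t (1# - w) s ⟩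
    - 1# * w * t * ((1# - w) ⁻¹ * (1# - w) * (s ⁻¹ * s))
      ≈⟨ *-congˡ (trans (*-cong (⁻¹-inverseˡ 1-w≉0) (⁻¹-inverseˡ s≉0)) (*-identityˡ 1#)) ⟩
    - 1# * w * t * 1#
      ≈⟨ *-identityʳ _ ⟩
    - 1# * w * t ∎

  ρ≈1⇒w[s-t]≈s : s ≉ 0# → ρ s t w ≈ 1# → w * (s - t) ≈ s
  ρ≈1⇒w[s-t]≈s {s} {t} {w} s≉0 ρ≈1 = [1-w]s≈-wt⇒w[s-t]≈s (begin
    (1# - w) * s                 ≈⟨ *-identityˡ _ ⟨
    1# * ((1# - w) * s)          ≈⟨ *-congʳ ρ≈1 ⟨
    ρ s t w * ((1# - w) * s)     ≈⟨ ρ*≈-wt 1-w≉0 s≉0 ⟩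
    - 1# * w * t                 ∎)
    where
    -- At w = 1 the junk inverse makes `ρ s t w` vanish, so it cannot be 1.
    1-w≉0 : 1# - w ≉ 0#
    1-w≉0 1-w≈0 = 1≉0 (begin
      1#                                    ≈⟨ ρ≈1 ⟨
      - 1# * w * (1# - w) ⁻¹ * s ⁻¹ * t     ≈⟨ *-congʳ (*-congʳ (*-congˡ (⁻¹-zero 1-w≈0))) ⟩
      - 1# * w * 0# * s ⁻¹ * t              ≈⟨ *-congʳ (trans (*-congʳ (zeroʳ _)) (zeroˡ _)) ⟩
      0# * t                                ≈⟨ zeroˡ t ⟩
      0#                                    ∎)

  w[s-t]≈s⇒ρ≈1 : s ≉ 0# → t ≉ 0# → w * (s - t) ≈ s → ρ s t w ≈ 1#
  w[s-t]≈s⇒ρ≈1 {s} {t} {w} s≉0 t≉0 eq = *-cancelˡ (x*y≉0 1-w≉0 s≉0) (begin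
    (1# - w) * s * ρ s t w       ≈⟨ *-comm _ _ ⟩
    ρ s t w * ((1# - w) * s)     ≈⟨ ρ*≈-wt 1-w≉0 s≉0 ⟩
    - 1# * w * t                 ≈⟨ w[s-t]≈s⇒[1-w]s≈-wt eq ⟨
    (1# - w) * s                 ≈⟨ *-identityʳ _ ⟨
    (1# - w) * s * 1#            ∎)
    where
    w≉0 : w ≉ 0#
    w≉0 w≈0 = s≉0 (trans (sym eq) (trans (*-congʳ w≈0) (zeroˡ _)))
    -- At w = 1 the equation would give - w t = 0, against w ≠ 0 and t ≠ 0.
    1-w≉0 : 1# - w ≉ 0#
    1-w≉0 1-w≈0 = x*y≉0 (x*y≉0 -1≉0 w≉0) t≉0
      (trans (sym (w[s-t]≈s⇒[1-w]s≈-wt eq)) (trans (*-congʳ 1-w≈0) (zeroˡ s)))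

  a[ux/a]≈ux : ∀ {a} → a ≉ 0# → ∀ u x → a * (u * (x / a)) ≈ u * x
  a[ux/a]≈ux {a} a≉0 u x = begin
    a * (u * (x * a ⁻¹))   ≈⟨ solve 4 (λ a u x b → a ⊕ (u ⊕ (x ⊕ b)) ⊜ (u ⊕ x) ⊕ (b ⊕ a)) refl a u x (a ⁻¹) ⟩
    u * x * (a ⁻¹ * a)     ≈⟨ *-congˡ (⁻¹-inverseˡ a≉0) ⟩
    u * x * 1#             ≈⟨ *-identityʳ _ ⟩
    u * x                  ∎

  rescale : ∀ {t} → t ≉ 1# → ∀ x y u v →
            1# - u * x - v * y - t ≈ (1# - t) * (1# - u * (x / (1# - t)) - v * (y / (1# - t)))
  rescale {t} t≉1 x y u v = sym (begin
    (1# - t) * (1# - u * (x / (1# - t)) - v * (y / (1# - t)))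
      ≈⟨ x[y-z]≈xy-xz _ _ _ ⟩
    (1# - t) * (1# - u * (x / (1# - t))) - (1# - t) * (v * (y / (1# - t)))
      ≈⟨ +-cong (x[y-z]≈xy-xz _ _ _) (-‿cong (a[ux/a]≈ux 1-t≉0 v y)) ⟩
    (1# - t) * 1# - (1# - t) * (u * (x / (1# - t))) - v * y
      ≈⟨ +-congʳ (+-cong (*-identityʳ _) (-‿cong (a[ux/a]≈ux 1-t≉0 u x))) ⟩
    1# - t - u * x - v * y
      ≈⟨ +.solve 4 (λ a t u v → ((a +.⊕ t) +.⊕ u) +.⊕ v +.⊜ ((a +.⊕ u) +.⊕ v) +.⊕ t) refl 1# (- t) (- (u * x)) (- (v * y)) ⟩
    1# - u * x - v * y - t ∎)
    where
    1-t≉0 : 1# - t ≉ 0#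
    1-t≉0 = x-y≉0 (λ 1≈t → t≉1 (sym 1≈t))

  -[x/t]*-[t/x]≈1 : ∀ {x t} → x ≉ 0# → t ≉ 0# → - (x / t) * - (t / x) ≈ 1#
  -[x/t]*-[t/x]≈1 {x} {t} x≉0 t≉0 = begin
    - (x / t) * - (t / x)              ≈⟨ -‿distribˡ-* _ _ ⟨
    - (x / t * - (t / x))              ≈⟨ -‿cong (-‿distribʳ-* _ _) ⟨
    - - (x / t * (t / x))              ≈⟨ -‿involutive _ ⟩
    x * t ⁻¹ * (t * x ⁻¹)              ≈⟨ solve 4 (λ x j t i → (x ⊕ j) ⊕ (t ⊕ i) ⊜ (x ⊕ i) ⊕ (t ⊕ j)) refl x (t ⁻¹) t (x ⁻¹) ⟩
    x * x ⁻¹ * (t * t ⁻¹)              ≈⟨ *-cong (⁻¹-inverseʳ x≉0) (⁻¹-inverseʳ t≉0) ⟩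
    1# * 1#                            ≈⟨ *-identityˡ 1# ⟩
    1#                                 ∎

-- The mean over θ for a fixed value of s.

module CharacterSumKernel {q c ℓ k ℓ₁ ℓ₂} (𝔽 : FiniteField q c ℓ) (K : HeytingField k ℓ₁ ℓ₂) where
  open Characters 𝔽 K
  open CharacterProperties 𝔽 K
  open CommutativeRing commutativeRing using (semiring; ring; *-commutativeMonoid)
  open RingProperties ring using (x≈y⇒x∙y⁻¹≈ε; -0#≈0#)
  open Sum semiring using (sum-cong-≋; ∑-comm; *-distribˡ-sum)
  open CommutativeMonoidSolver *-commutativeMonoid
  module FI = FieldIdentities 𝔽
  open SetoidReasoning setoid

  -1²≈1 : ∀ χ → χ ⟨ -1F ⟩ * χ ⟨ -1F ⟩ ≈ 1#
  -1²≈1 χ = trans (sym (χ-* χ _ _)) (trans (Character.cong χ FI.-1*-1≈1) (χ-one χ))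

  -- Once the Jacobi sum is expanded, all factors involving θ merge into one value, at a point
  -- independent of θ. Orthogonality then applies for each `w` separately.
  binom-summand : ∀ A θ s t →
    binom (A ∙ θ) θ * (A ∙ θ) ⁻¹ ⟨ s ⟩ * θ ⟨ t ⟩ ≈ ∑𝔽[ w ] (A ⟨ w ⟩ * A ⟨ s F.⁻¹ ⟩ * θ ⟨ FI.ρ s t w ⟩)
  binom-summand A θ s t = begin
    θ ⟨ -1F ⟩ * ∑𝔽 f * (A ∙ θ) ⁻¹ ⟨ s ⟩ * θ ⟨ t ⟩
      ≈⟨ *-congʳ (*-congˡ (χ⁻¹-value (A ∙ θ) s)) ⟩
    θ ⟨ -1F ⟩ * ∑𝔽 f * (A ⟨ s F.⁻¹ ⟩ * θ ⟨ s F.⁻¹ ⟩) * θ ⟨ t ⟩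
      ≈⟨ solve 4 (λ a b c d → ((a ⊕ b) ⊕ c) ⊕ d ⊜ b ⊕ ((a ⊕ c) ⊕ d)) refl _ _ _ _ ⟩
    ∑𝔽 f * e
      ≈⟨ ∑𝔽-*ʳ f e ⟩
    ∑𝔽[ w ] (f w * e)
      ≈⟨ ∑𝔽-cong term ⟩
    ∑𝔽[ w ] (A ⟨ w ⟩ * A ⟨ s F.⁻¹ ⟩ * θ ⟨ FI.ρ s t w ⟩) ∎
    where
    f : F.Carrier → Carrier
    f w = (A ∙ θ) ⟨ w ⟩ * θ ⁻¹ ⟨ F.1# F.- w ⟩
    e = θ ⟨ -1F ⟩ * (A ⟨ s F.⁻¹ ⟩ * θ ⟨ s F.⁻¹ ⟩) * θ ⟨ t ⟩
    term : ∀ w → f w * e ≈ A ⟨ w ⟩ * A ⟨ s F.⁻¹ ⟩ * θ ⟨ FI.ρ s t w ⟩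
    term w = begin
      A ⟨ w ⟩ * θ ⟨ w ⟩ * θ ⁻¹ ⟨ F.1# F.- w ⟩ * e
        ≈⟨ *-congʳ (*-congˡ (χ⁻¹-value θ _)) ⟩
      A ⟨ w ⟩ * θ ⟨ w ⟩ * θ ⟨ (F.1# F.- w) F.⁻¹ ⟩ * e
        ≈⟨ solve 7 (λ a b c d e f g → ((a ⊕ b) ⊕ c) ⊕ ((d ⊕ (e ⊕ f)) ⊕ g) ⊜ (a ⊕ e) ⊕ ((((d ⊕ b) ⊕ c) ⊕ f) ⊕ g))
             refl _ _ _ _ _ _ _ ⟩
      A ⟨ w ⟩ * A ⟨ s F.⁻¹ ⟩ * (θ ⟨ -1F ⟩ * θ ⟨ w ⟩ * θ ⟨ (F.1# F.- w) F.⁻¹ ⟩ * θ ⟨ s F.⁻¹ ⟩ * θ ⟨ t ⟩)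
        ≈⟨ *-congˡ (trans (χ-* θ _ _) (*-congʳ (trans (χ-* θ _ _) (*-congʳ (trans (χ-* θ _ _) (*-congʳ (χ-* θ _ _))))))) ⟨
      A ⟨ w ⟩ * A ⟨ s F.⁻¹ ⟩ * θ ⟨ FI.ρ s t w ⟩ ∎

  module _ (char0 : CharacteristicZero) (ζ : Carrier) (ζ-primitive : IsPrimitiveRoot (q ∸ 1) ζ)
           {m : ℕ} (characters : Enumeration m characterSetoid) where
    open Separation ζ ζ-primitive

    -- By orthogonality, the indicator function of `F.1#`.
    mean : F.Carrier → Carrier
    mean x = 1/[q-1] char0 * ∑[ θ ∈ characters ] (θ ⟨ x ⟩)

    mean-cong : ∀ {x y} → x F.≈ y → mean x ≈ mean y
    mean-cong x≈y = *-congˡ (sum-cong-≋ (λ i → Character.cong (Inverse.to characters i) x≈y))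

    mean-one : ∀ {x} → x F.≈ F.1# → mean x ≈ 1#
    mean-one x≈1 = trans (mean-cong x≈1) (trans (*-congˡ (∑-characters-one characters)) (recip-inverseˡ _))

    mean-≉one : ∀ {x} → x F.≉ F.1# → mean x ≈ 0#
    mean-≉one x≉1 = trans (*-congˡ (∑-characters-vanishes characters x≉1)) (zeroʳ _)

    ∑-kernel : ∀ A s t →
      1/[q-1] char0 * ∑[ θ ∈ characters ] (binom (A ∙ θ) θ * (A ∙ θ) ⁻¹ ⟨ s ⟩ * θ ⟨ t ⟩) ≈
      ∑𝔽[ w ] (A ⟨ w ⟩ * A ⟨ s F.⁻¹ ⟩ * mean (FI.ρ s t w))
    ∑-kernel A s t = begin
      r * ∑[ θ ∈ characters ] (binom (A ∙ θ) θ * (A ∙ θ) ⁻¹ ⟨ s ⟩ * θ ⟨ t ⟩)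
        ≈⟨ *-congˡ (sum-cong-≋ (λ i → binom-summand A (Inverse.to characters i) s t)) ⟩
      r * ∑[ θ ∈ characters ] ∑𝔽[ w ] (a w * θ ⟨ FI.ρ s t w ⟩)
        ≈⟨ *-congˡ (∑-comm (λ i j → a (F.element j) * Inverse.to characters i ⟨ FI.ρ s t (F.element j) ⟩)) ⟩
      r * ∑𝔽[ w ] ∑[ θ ∈ characters ] (a w * θ ⟨ FI.ρ s t w ⟩)
        ≈⟨ ∑𝔽-*ˡ r (λ w → ∑[ θ ∈ characters ] (a w * θ ⟨ FI.ρ s t w ⟩)) ⟩
      ∑𝔽[ w ] (r * ∑[ θ ∈ characters ] (a w * θ ⟨ FI.ρ s t w ⟩))
        ≈⟨ ∑𝔽-cong (λ w → trans
             (*-congˡ (sym (*-distribˡ-sum (a w) (λ i → Inverse.to characters i ⟨ FI.ρ s t w ⟩))))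
             (solve 3 (λ r a s → r ⊕ (a ⊕ s) ⊜ a ⊕ (r ⊕ s)) refl r (a w) (∑[ θ ∈ characters ] (θ ⟨ FI.ρ s t w ⟩)))) ⟩
      ∑𝔽[ w ] (a w * mean (FI.ρ s t w)) ∎
      where
      r = 1/[q-1] char0
      a : F.Carrier → Carrier
      a w = A ⟨ w ⟩ * A ⟨ s F.⁻¹ ⟩

    kernel : ∀ A s {t} → t F.≉ F.0# →
      1/[q-1] char0 * ∑[ θ ∈ characters ] (binom (A ∙ θ) θ * (A ∙ θ) ⁻¹ ⟨ s ⟩ * θ ⟨ t ⟩) ≈
      A ⁻¹ ⟨ s F.- t ⟩ - A ⁻¹ ⟨ F.- t ⟩ * (1# - ε ⟨ s ⟩)
    kernel A s {t} t≉0 = trans (∑-kernel A s t) (helper (s F.≟ F.0#) (s F.≟ t))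
      where
      summand : F.Carrier → Carrier
      summand w = A ⟨ w ⟩ * A ⟨ s F.⁻¹ ⟩ * mean (FI.ρ s t w)

      summand-cong : ∀ {w w′} → w F.≈ w′ → summand w ≈ summand w′
      summand-cong w≈w′ = *-cong (*-congʳ (Character.cong A w≈w′)) (mean-cong (FI.ρ-cong w≈w′))

      summand-zero : ∀ {w} → FI.ρ s t w F.≉ F.1# → summand w ≈ 0#
      summand-zero ρ≉1 = trans (*-congˡ (mean-≉one ρ≉1)) (zeroʳ _)

      correction-zero : s F.≉ F.0# → ∀ a b → a - b * (1# - ε ⟨ s ⟩) ≈ a
      correction-zero s≉0 a b = trans
        (+-congˡ (trans (-‿cong (trans (*-congˡ (1-ε-nonzero s≉0)) (zeroʳ b))) -0#≈0#)) (+-identityʳ a)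

      helper : Dec (s F.≈ F.0#) → Dec (s F.≈ t) →
               ∑𝔽 summand ≈ A ⁻¹ ⟨ s F.- t ⟩ - A ⁻¹ ⟨ F.- t ⟩ * (1# - ε ⟨ s ⟩)
      -- Every summand contains A(1/s), which is 0 by the junk inverse, whereas A⁻¹(s - t) is
      -- A⁻¹(-t). The correction term makes up for this.
      helper (yes s≈0) _ = trans
        (∑𝔽-zero {summand} (λ w → trans (*-congʳ (trans (*-congˡ (χ-zero A (FP.⁻¹-zero s≈0))) (zeroʳ _))) (zeroˡ _)))
        (sym (x≈y⇒x∙y⁻¹≈ε (begin
          A ⁻¹ ⟨ s F.- t ⟩                      ≈⟨ Character.cong (A ⁻¹) (F.trans (F.+-congʳ s≈0) (F.+-identityˡ _)) ⟩
          A ⁻¹ ⟨ F.- t ⟩                        ≈⟨ *-identityʳ _ ⟨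
          A ⁻¹ ⟨ F.- t ⟩ * 1#                   ≈⟨ *-congˡ (1-ε-zero s≈0) ⟨
          A ⁻¹ ⟨ F.- t ⟩ * (1# - ε ⟨ s ⟩)       ∎)))
      -- For s = t ≠ 0 the equation w (s - t) = s has no solution, in agreement with A⁻¹(0) = 0.
      helper (no s≉0) (yes s≈t) = begin
        ∑𝔽 summand                                                ≈⟨ ∑𝔽-zero {summand} (λ w → summand-zero (λ ρ≈1 → s≉0 (s≈0 w ρ≈1))) ⟩
        0#                                                        ≈⟨ χ-zero (A ⁻¹) s-t≈0 ⟨
        A ⁻¹ ⟨ s F.- t ⟩                                          ≈⟨ correction-zero s≉0 _ _ ⟨
        A ⁻¹ ⟨ s F.- t ⟩ - A ⁻¹ ⟨ F.- t ⟩ * (1# - ε ⟨ s ⟩)        ∎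
        where
        s-t≈0 : s F.- t F.≈ F.0#
        s-t≈0 = F.trans (F.+-congʳ s≈t) (F.-‿inverseʳ t)
        s≈0 : ∀ w → FI.ρ s t w F.≈ F.1# → s F.≈ F.0#
        s≈0 w ρ≈1 = F.trans (F.sym (FI.ρ≈1⇒w[s-t]≈s s≉0 ρ≈1)) (F.trans (F.*-congˡ s-t≈0) (F.zeroʳ w))
      -- Only w₀ = s/(s - t) contributes, and s cancels in A(w₀) A(1/s).
      helper (no s≉0) (no s≉t) = begin
        ∑𝔽 summand
          ≈⟨ ∑𝔽-single {summand} w₀ summand-cong
               (λ w w≉w₀ → summand-zero λ ρ≈1 → w≉w₀ (unique w (FI.ρ≈1⇒w[s-t]≈s s≉0 ρ≈1))) ⟩
        A ⟨ w₀ ⟩ * A ⟨ s F.⁻¹ ⟩ * mean (FI.ρ s t w₀)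
          ≈⟨ trans (*-congˡ (mean-one (FI.w[s-t]≈s⇒ρ≈1 s≉0 t≉0 w₀[s-t]≈s))) (*-identityʳ _) ⟩
        A ⟨ w₀ ⟩ * A ⟨ s F.⁻¹ ⟩
          ≈⟨ χ-* A w₀ _ ⟨
        A ⟨ w₀ F.* s F.⁻¹ ⟩
          ≈⟨ Character.cong A (FP.*-cancelˡ s≉0 (F.trans (F.*-comm _ _)
               (F.trans (F.*-assoc _ _ _) (F.trans (F.*-congˡ (FP.⁻¹-inverseˡ s≉0)) (F.*-identityʳ _))))) ⟩
        A ⟨ (s F.- t) F.⁻¹ ⟩
          ≈⟨ χ⁻¹-value A _ ⟨
        A ⁻¹ ⟨ s F.- t ⟩
          ≈⟨ correction-zero s≉0 _ _ ⟨
        A ⁻¹ ⟨ s F.- t ⟩ - A ⁻¹ ⟨ F.- t ⟩ * (1# - ε ⟨ s ⟩) ∎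
        where
        s-t≉0 = FP.x-y≉0 s≉t
        w₀ : F.Carrier
        w₀ = s F.* (s F.- t) F.⁻¹
        w₀[s-t]≈s : w₀ F.* (s F.- t) F.≈ s
        w₀[s-t]≈s = F.trans (F.*-assoc _ _ _) (F.trans (F.*-congˡ (FP.⁻¹-inverseˡ s-t≉0)) (F.*-identityʳ s))
        unique : ∀ w → w F.* (s F.- t) F.≈ s → w F.≈ w₀
        unique w eq = FP.*-cancelˡ s-t≉0 (F.trans (F.*-comm _ _) (F.trans eq (F.trans (F.sym w₀[s-t]≈s) (F.*-comm _ _))))

-- Changes of variables in the binomial coefficient and in ₂F₁.

module Transformations {q c ℓ k ℓ₁ ℓ₂} (𝔽 : FiniteField q c ℓ) (K : HeytingField k ℓ₁ ℓ₂) where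
  open Characters 𝔽 K
  open CharacterProperties 𝔽 K
  open CharacterSumKernel 𝔽 K using (-1²≈1)
  open CommutativeRing commutativeRing using (*-commutativeMonoid)
  open CommutativeMonoidSolver *-commutativeMonoid
  module FI = FieldIdentities 𝔽
  open SetoidReasoning setoid

  χ-neg : ∀ χ x → χ ⟨ F.- x ⟩ ≈ χ ⟨ -1F ⟩ * χ ⟨ x ⟩
  χ-neg χ x = trans (Character.cong χ (F.sym (RingProperties.-1*x≈-x F.ring x))) (χ-* χ _ _)

  χ⁻¹-neg1 : ∀ χ → χ ⁻¹ ⟨ -1F ⟩ ≈ χ ⟨ -1F ⟩
  χ⁻¹-neg1 χ = trans (χ⁻¹-value χ -1F) (Character.cong χ (FP.⁻¹-unique FI.-1*-1≈1))

  χ⁻¹-⁻¹ : ∀ χ x → χ ⁻¹ ⟨ x F.⁻¹ ⟩ ≈ χ ⟨ x ⟩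
  χ⁻¹-⁻¹ χ x = trans (χ⁻¹-value χ _) (Character.cong χ (FP.⁻¹-involutive x))

  χ-[1-y] : ∀ χ {x y} → x F.* y F.≈ F.1# → χ ⟨ F.1# F.- y ⟩ ≈ χ ⟨ -1F ⟩ * χ ⟨ F.1# F.- x ⟩ * χ ⁻¹ ⟨ x ⟩
  χ-[1-y] χ {x} {y} xy≈1 = begin
    χ ⟨ F.1# F.- y ⟩                                   ≈⟨ Character.cong χ (FI.xy≈1⇒1-y≈-[1-x]y xy≈1) ⟩
    χ ⟨ -1F F.* (F.1# F.- x) F.* y ⟩                   ≈⟨ trans (χ-* χ _ _) (*-cong (χ-* χ _ _) (Character.cong χ (F.sym (FP.⁻¹-unique xy≈1)))) ⟩
    χ ⟨ -1F ⟩ * χ ⟨ F.1# F.- x ⟩ * χ ⟨ x F.⁻¹ ⟩        ≈⟨ *-congˡ (χ⁻¹-value χ x) ⟨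
    χ ⟨ -1F ⟩ * χ ⟨ F.1# F.- x ⟩ * χ ⁻¹ ⟨ x ⟩          ∎

  χ*χ⁻¹≈1 : ∀ χ {x} → x F.≉ F.0# → χ ⟨ x ⟩ * χ ⁻¹ ⟨ x ⟩ ≈ 1#
  χ*χ⁻¹≈1 χ x≉0 = trans (*-comm _ _) (χ⁻¹-* χ x≉0)

  -- The Jacobi sum in the definition has the weight C⁻¹(1 - u), the integrals of hypergeometric
  -- type have B⁻¹C(1 - u). Putting w = 1 - u and replacing u by 1 - 1/w = - u/w turns the one into
  -- the other, up to the sign B(-1).
  binom-integral : ∀ B C → binom B C ≈ (B ∙ C) ⟨ -1F ⟩ * ∑𝔽[ u ] (B ⟨ u ⟩ * (B ⁻¹ ∙ C) ⟨ F.1# F.- u ⟩)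
  binom-integral B C = begin
    C ⟨ -1F ⟩ * ∑𝔽 f
      ≈⟨ *-congˡ (∑𝔽-reindex φ f (λ x≈y → *-cong (Character.cong B x≈y) (Character.cong (C ⁻¹) (F.+-congˡ (F.-‿cong x≈y))))) ⟩
    C ⟨ -1F ⟩ * ∑𝔽[ u ] (f (Inverse.to φ u))
      ≈⟨ *-congˡ (∑𝔽-cong (λ u → term u (F.1# F.- u F.≟ F.0#))) ⟩
    C ⟨ -1F ⟩ * ∑𝔽[ u ] (B ⟨ -1F ⟩ * h u)
      ≈⟨ *-congˡ (∑𝔽-*ˡ (B ⟨ -1F ⟩) h) ⟨
    C ⟨ -1F ⟩ * (B ⟨ -1F ⟩ * ∑𝔽 h)
      ≈⟨ solve 3 (λ c b s → c ⊕ (b ⊕ s) ⊜ (b ⊕ c) ⊕ s) refl _ _ _ ⟩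
    (B ∙ C) ⟨ -1F ⟩ * ∑𝔽 h ∎
    where
    -- u ↦ 1 - 1/(1 - u) = u/(u - 1)
    φ : Inverse F.setoid F.setoid
    φ = Composition.inverse FI.reflection (Composition.inverse FI.inversion FI.reflection)
    f h : F.Carrier → Carrier
    f u = B ⟨ u ⟩ * C ⁻¹ ⟨ F.1# F.- u ⟩
    h u = B ⟨ u ⟩ * (B ⁻¹ ∙ C) ⟨ F.1# F.- u ⟩
    C-factor : ∀ w → C ⁻¹ ⟨ F.1# F.- (F.1# F.- w F.⁻¹) ⟩ ≈ C ⟨ w ⟩
    C-factor w = trans (Character.cong (C ⁻¹) (FI.1-[1-x]≈x _)) (χ⁻¹-⁻¹ C w)
    term : ∀ u → Dec (F.1# F.- u F.≈ F.0#) → f (Inverse.to φ u) ≈ B ⟨ -1F ⟩ * h u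
    -- The point u = 1 is fixed by `φ`, and both sides vanish there.
    term u (yes w≈0) = begin
      f (Inverse.to φ u)      ≈⟨ *-congˡ (trans (C-factor _) (χ-zero C w≈0)) ⟩
      _ * 0#                  ≈⟨ zeroʳ _ ⟩
      0#                      ≈⟨ zeroʳ _ ⟨
      B ⟨ -1F ⟩ * 0#          ≈⟨ *-congˡ (trans (*-congˡ (χ-zero (B ⁻¹ ∙ C) w≈0)) (zeroʳ _)) ⟨
      B ⟨ -1F ⟩ * h u         ∎
    term u (no w≉0) = begin
      f (Inverse.to φ u)
        ≈⟨ *-cong (χ-[1-y] B (FP.⁻¹-inverseʳ w≉0)) (C-factor w) ⟩
      B ⟨ -1F ⟩ * B ⟨ F.1# F.- w ⟩ * B ⁻¹ ⟨ w ⟩ * C ⟨ w ⟩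
        ≈⟨ *-congʳ (*-congʳ (*-congˡ (Character.cong B (FI.1-[1-x]≈x u)))) ⟩
      B ⟨ -1F ⟩ * B ⟨ u ⟩ * B ⁻¹ ⟨ w ⟩ * C ⟨ w ⟩
        ≈⟨ solve 4 (λ a b c d → ((a ⊕ b) ⊕ c) ⊕ d ⊜ a ⊕ (b ⊕ (c ⊕ d))) refl _ _ _ _ ⟩
      B ⟨ -1F ⟩ * h u ∎
      where w = F.1# F.- u

  -- Under u ↦ 1/u each factor of the form 1 - 1/z becomes -(1 - z)/z. The powers of u released in
  -- this way combine to B(u), and the last factor also releases A(X); what remains is signs.
  ₂F₁-inversion : ∀ A B C {X Y} → X F.* Y F.≈ F.1# →
    ₂F₁ A (A ∙ C ⁻¹) (A ∙ B ⁻¹) Y ≈ A ⟨ -1F ⟩ * A ⟨ X ⟩ * (B ∙ C) ⟨ -1F ⟩ * ₂F₁ A B C X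
  ₂F₁-inversion A B C {X} {Y} XY≈1 = begin
    ε ⟨ Y ⟩ * sgn * ∑𝔽 f
      ≈⟨ *-cong (*-congʳ (ε-one Y≉0)) (∑𝔽-reindex FI.inversion f f-cong) ⟩
    1# * sgn * ∑𝔽[ u ] (f (u F.⁻¹))
      ≈⟨ *-congˡ (trans (∑𝔽-cong (λ u → term u (u F.≟ F.0#))) (sym (∑𝔽-*ˡ e h))) ⟩
    1# * sgn * (e * ∑𝔽 h)
      ≈⟨ *-congʳ (*-congˡ (*-cong (*-congˡ (χ⁻¹-neg1 C)) (*-congˡ (χ⁻¹-neg1 B)))) ⟩
    1# * (a * c′ * (a * b)) * (c′ * b * a * A ⟨ X ⟩ * ∑𝔽 h)
      ≈⟨ solve 6 (λ o a b c x s → (o ⊕ ((a ⊕ c) ⊕ (a ⊕ b))) ⊕ ((((c ⊕ b) ⊕ a) ⊕ x) ⊕ s) ⊜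
                                  (a ⊕ a) ⊕ (((a ⊕ x) ⊕ (b ⊕ c)) ⊕ ((o ⊕ (b ⊕ c)) ⊕ s))) refl 1# a b c′ (A ⟨ X ⟩) (∑𝔽 h) ⟩
    a * a * (a * A ⟨ X ⟩ * (b * c′) * (1# * (b * c′) * ∑𝔽 h))
      ≈⟨ trans (*-congʳ (-1²≈1 A)) (*-identityˡ _) ⟩
    a * A ⟨ X ⟩ * (b * c′) * (1# * (b * c′) * ∑𝔽 h)
      ≈⟨ *-congˡ (*-congʳ (*-congʳ (ε-one X≉0))) ⟨
    A ⟨ -1F ⟩ * A ⟨ X ⟩ * (B ∙ C) ⟨ -1F ⟩ * ₂F₁ A B C X ∎
    where
    X≉0 : X F.≉ F.0#
    X≉0 = FP.x*y≈1⇒x≉0 XY≈1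
    Y≉0 : Y F.≉ F.0#
    Y≉0 = FP.x*y≈1⇒x≉0 (F.trans (F.*-comm Y X) XY≈1)
    a b c′ e sgn : Carrier
    a = A ⟨ -1F ⟩
    b = B ⟨ -1F ⟩
    c′ = C ⟨ -1F ⟩
    sgn = ((A ∙ C ⁻¹) ∙ (A ∙ B ⁻¹)) ⟨ -1F ⟩
    e = c′ * b * a * A ⟨ X ⟩
    f h : F.Carrier → Carrier
    f u = (A ∙ C ⁻¹) ⟨ u ⟩ * ((A ∙ C ⁻¹) ⁻¹ ∙ (A ∙ B ⁻¹)) ⟨ F.1# F.- u ⟩ * A ⁻¹ ⟨ F.1# F.- Y F.* u ⟩
    h u = B ⟨ u ⟩ * (B ⁻¹ ∙ C) ⟨ F.1# F.- u ⟩ * A ⁻¹ ⟨ F.1# F.- X F.* u ⟩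
    f-cong : ∀ {u v} → u F.≈ v → f u ≈ f v
    f-cong u≈v = *-cong (*-cong (Character.cong (A ∙ C ⁻¹) u≈v)
      (Character.cong ((A ∙ C ⁻¹) ⁻¹ ∙ (A ∙ B ⁻¹)) (F.+-congˡ (F.-‿cong u≈v))))
      (Character.cong (A ⁻¹) (F.+-congˡ (F.-‿cong (F.*-congˡ u≈v))))
    -- The factor `A` cancels only up to ε, which `C` absorbs, so the identity includes z = 0.
    weight : ∀ z → ((A ∙ C ⁻¹) ⁻¹ ∙ (A ∙ B ⁻¹)) ⟨ z ⟩ ≈ C ⟨ z ⟩ * B ⁻¹ ⟨ z ⟩
    weight z = begin
      (A ∙ C ⁻¹) ⁻¹ ⟨ z ⟩ * (A ⟨ z ⟩ * B ⁻¹ ⟨ z ⟩)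
        ≈⟨ *-congʳ (trans (χ⁻¹-value (A ∙ C ⁻¹) z) (*-cong (sym (χ⁻¹-value A z)) (χ⁻¹-⁻¹ C z))) ⟩
      A ⁻¹ ⟨ z ⟩ * C ⟨ z ⟩ * (A ⟨ z ⟩ * B ⁻¹ ⟨ z ⟩)
        ≈⟨ solve 4 (λ a c b d → (a ⊕ c) ⊕ (b ⊕ d) ⊜ ((a ⊕ b) ⊕ c) ⊕ d) refl _ _ _ _ ⟩
      A ⁻¹ ⟨ z ⟩ * A ⟨ z ⟩ * C ⟨ z ⟩ * B ⁻¹ ⟨ z ⟩
        ≈⟨ *-congʳ (trans (*-congʳ (χ⁻¹*χ≈ε A z)) (ε-* C z)) ⟩
      C ⟨ z ⟩ * B ⁻¹ ⟨ z ⟩ ∎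
    term : ∀ u → Dec (u F.≈ F.0#) → f (u F.⁻¹) ≈ e * h u
    term u (yes u≈0) = trans
      (trans (*-congʳ (trans (*-congʳ (χ-zero (A ∙ C ⁻¹) (FP.⁻¹-zero u≈0))) (zeroˡ _))) (zeroˡ _))
      (sym (trans (*-congˡ (trans (*-congʳ (trans (*-congʳ (χ-zero B u≈0)) (zeroˡ _))) (zeroˡ _))) (zeroʳ _)))
    term u (no u≉0) = begin
      A ⟨ u F.⁻¹ ⟩ * C ⁻¹ ⟨ u F.⁻¹ ⟩ * ((A ∙ C ⁻¹) ⁻¹ ∙ (A ∙ B ⁻¹)) ⟨ z ⟩ * A ⁻¹ ⟨ F.1# F.- Y F.* u F.⁻¹ ⟩
        -- The last factor is of the form 1 - 1/z with z = X u, because X Y = 1.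
        ≈⟨ *-cong (*-cong (*-cong (sym (χ⁻¹-value A u)) (χ⁻¹-⁻¹ C u)) (weight z)) (χ-[1-y] (A ⁻¹) Xu*Y/u≈1) ⟩
      A ⁻¹ ⟨ u ⟩ * C ⟨ u ⟩ * (C ⟨ z ⟩ * B ⁻¹ ⟨ z ⟩) * (A ⁻¹ ⟨ -1F ⟩ * A ⁻¹ ⟨ F.1# F.- X F.* u ⟩ * A ⁻¹ ⁻¹ ⟨ X F.* u ⟩)
        ≈⟨ *-cong (*-congˡ (*-cong (χ-[1-y] C u*u⁻¹≈1) (trans (χ-[1-y] (B ⁻¹) u*u⁻¹≈1) (*-cong (*-congʳ (χ⁻¹-neg1 B)) (χ⁻¹⁻¹ B u)))))
                  (*-cong (*-congʳ (χ⁻¹-neg1 A)) (trans (χ⁻¹⁻¹ A _) (χ-* A X u))) ⟩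
      A ⁻¹ ⟨ u ⟩ * C ⟨ u ⟩ * (c′ * C ⟨ F.1# F.- u ⟩ * C ⁻¹ ⟨ u ⟩ * (b * B ⁻¹ ⟨ F.1# F.- u ⟩ * B ⟨ u ⟩)) *
      (a * A ⁻¹ ⟨ F.1# F.- X F.* u ⟩ * (A ⟨ X ⟩ * A ⟨ u ⟩))
        ≈⟨ solve 12 (λ Āu Cu c′ C1 C̄u b B1 Bu a A1 AX Au →
             ((Āu ⊕ Cu) ⊕ (((c′ ⊕ C1) ⊕ C̄u) ⊕ ((b ⊕ B1) ⊕ Bu))) ⊕ ((a ⊕ A1) ⊕ (AX ⊕ Au)) ⊜
             ((Āu ⊕ Au) ⊕ (Cu ⊕ C̄u)) ⊕ ((((c′ ⊕ b) ⊕ a) ⊕ AX) ⊕ ((Bu ⊕ (B1 ⊕ C1)) ⊕ A1)))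
             refl _ _ _ _ _ _ _ _ _ _ _ _ ⟩
      A ⁻¹ ⟨ u ⟩ * A ⟨ u ⟩ * (C ⟨ u ⟩ * C ⁻¹ ⟨ u ⟩) * (e * h u)
        ≈⟨ *-congʳ (trans (*-cong (χ⁻¹-* A u≉0) (χ*χ⁻¹≈1 C u≉0)) (*-identityˡ 1#)) ⟩
      1# * (e * h u)
        ≈⟨ *-identityˡ _ ⟩
      e * h u ∎
      where
      z = F.1# F.- u F.⁻¹
      u*u⁻¹≈1 = FP.⁻¹-inverseʳ u≉0
      χ⁻¹⁻¹ : ∀ χ x → χ ⁻¹ ⁻¹ ⟨ x ⟩ ≈ χ ⟨ x ⟩
      χ⁻¹⁻¹ χ x = trans (χ⁻¹-value (χ ⁻¹) x) (χ⁻¹-⁻¹ χ x)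
      Xu*Y/u≈1 : X F.* u F.* (Y F.* u F.⁻¹) F.≈ F.1#
      Xu*Y/u≈1 = F.trans (interchange X u Y (u F.⁻¹)) (F.trans (F.*-cong XY≈1 u*u⁻¹≈1) (F.*-identityˡ F.1#))
        where open CommutativeSemigroupProperties F.*-commutativeSemigroup using (interchange)

-- Double sums, the mean of F₂ over θ, and the cancelling ₂F₁ terms.

module Appell {q c ℓ k ℓ₁ ℓ₂} (𝔽 : FiniteField q c ℓ) (K : HeytingField k ℓ₁ ℓ₂) where
  open Characters 𝔽 K
  open CharacterProperties 𝔽 K
  open CharacterSumKernel 𝔽 K
  open Transformations 𝔽 K
  open CommutativeRing commutativeRing using (semiring; commutativeSemiring; ring; *-commutativeMonoid)
  open RingProperties ring using (x[y-z]≈xy-xz; ⁻¹-anti-homo-//; -‿distribˡ-*)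
  open Sum semiring using (sum-cong-≋; ∑-comm; *-distribˡ-sum)
  open CommutativeMonoidSolver *-commutativeMonoid
  private module NS = NaturalSolver commutativeSemiring
  open FieldIdentities 𝔽 using (rescale; -[x/t]*-[t/x]≈1)
  open SetoidReasoning setoid

  ∑𝔽² : (F.Carrier → F.Carrier → Carrier) → Carrier
  ∑𝔽² f = ∑𝔽[ u ] ∑𝔽[ v ] f u v

  ∑𝔽²-cong : ∀ {f g : F.Carrier → F.Carrier → Carrier} → (∀ u v → f u v ≈ g u v) → ∑𝔽² f ≈ ∑𝔽² g
  ∑𝔽²-cong f≈g = ∑𝔽-cong (λ u → ∑𝔽-cong (f≈g u))

  ∑𝔽²-*ˡ : ∀ a (f : F.Carrier → F.Carrier → Carrier) → a * ∑𝔽² f ≈ ∑𝔽² (λ u v → a * f u v)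
  ∑𝔽²-*ˡ a f = trans (∑𝔽-*ˡ a (λ u → ∑𝔽 (f u))) (∑𝔽-cong (λ u → ∑𝔽-*ˡ a (f u)))

  ∑𝔽²-*ʳ : ∀ (f : F.Carrier → F.Carrier → Carrier) a → ∑𝔽² f * a ≈ ∑𝔽² (λ u v → f u v * a)
  ∑𝔽²-*ʳ f a = trans (∑𝔽-*ʳ (λ u → ∑𝔽 (f u)) a) (∑𝔽-cong (λ u → ∑𝔽-*ʳ (f u) a))

  ∑𝔽²-+ : ∀ (f g : F.Carrier → F.Carrier → Carrier) → ∑𝔽² (λ u v → f u v + g u v) ≈ ∑𝔽² f + ∑𝔽² g
  ∑𝔽²-+ f g = trans (∑𝔽-cong (λ u → ∑𝔽-+ (f u) (g u))) (∑𝔽-+ (λ u → ∑𝔽 (f u)) (λ u → ∑𝔽 (g u)))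

  ∑𝔽²-product : ∀ (f g : F.Carrier → Carrier) → ∑𝔽² (λ u v → f u * g v) ≈ ∑𝔽 f * ∑𝔽 g
  ∑𝔽²-product f g = trans (∑𝔽-cong (λ u → sym (∑𝔽-*ˡ (f u) g))) (sym (∑𝔽-*ʳ f (∑𝔽 g)))

  ∑-characters-∑𝔽² : ∀ {m} (characters : Enumeration m characterSetoid)
    (f : Character → F.Carrier → F.Carrier → Carrier) →
    ∑[ θ ∈ characters ] ∑𝔽² (f θ) ≈ ∑𝔽² (λ u v → ∑[ θ ∈ characters ] f θ u v)
  ∑-characters-∑𝔽² characters f = trans
    (∑-comm (λ i j → ∑𝔽 (f (Inverse.to characters i) (F.element j))))
    (∑𝔽-cong (λ u → ∑-comm (λ i j → f (Inverse.to characters i) u (F.element j))))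

  -[a[b-c]]≈-ab+ac : ∀ a b c → - (a * (b - c)) ≈ - a * b + a * c
  -[a[b-c]]≈-ab+ac a b c = begin
    - (a * (b - c))      ≈⟨ -‿cong (x[y-z]≈xy-xz a b c) ⟩
    - (a * b - a * c)    ≈⟨ ⁻¹-anti-homo-// (a * b) (a * c) ⟩
    a * c - a * b        ≈⟨ +-comm _ _ ⟩
    - (a * b) + a * c    ≈⟨ +-congʳ (-‿distribˡ-* a b) ⟩
    - a * b + a * c      ∎

  -- Interchange of the mean over θ with the double integral. In the application `w` and `e` are the
  -- parts of F₂ free of θ, and `h` is the last factor, the only one depending on θ as well as on u
  -- and v.
  weighted-mean : ∀ {m} (characters : Enumeration m characterSetoid) r e
    (w : F.Carrier → F.Carrier → Carrier) (a b : Character → Carrier) (h : Character → F.Carrier → F.Carrier → Carrier) →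
    r * ∑[ θ ∈ characters ] (a θ * (e * ∑𝔽² (λ u v → w u v * h θ u v)) * b θ) ≈
    e * ∑𝔽² (λ u v → w u v * (r * ∑[ θ ∈ characters ] (a θ * h θ u v * b θ)))
  weighted-mean characters r e w a b h = begin
    r * ∑[ θ ∈ characters ] (a θ * (e * ∑𝔽² (λ u v → w u v * h θ u v)) * b θ)
      ≈⟨ *-congˡ (sum-cong-≋ (λ i → expand (Inverse.to characters i))) ⟩
    r * ∑[ θ ∈ characters ] (e * ∑𝔽² (λ u v → w u v * (a θ * h θ u v * b θ)))
      ≈⟨ *-congˡ (*-distribˡ-sum e (λ i → ∑𝔽² (g (Inverse.to characters i)))) ⟨
    r * (e * ∑[ θ ∈ characters ] ∑𝔽² (g θ))
      ≈⟨ *-congˡ (*-congˡ (∑-characters-∑𝔽² characters g)) ⟩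
    r * (e * ∑𝔽² (λ u v → ∑[ θ ∈ characters ] g θ u v))
      ≈⟨ swap r e _ ⟩
    e * (r * ∑𝔽² (λ u v → ∑[ θ ∈ characters ] g θ u v))
      ≈⟨ *-congˡ (∑𝔽²-*ˡ r (λ u v → ∑[ θ ∈ characters ] g θ u v)) ⟩
    e * ∑𝔽² (λ u v → r * ∑[ θ ∈ characters ] g θ u v)
      ≈⟨ *-congˡ (∑𝔽²-cong (λ u v → trans
           (*-congˡ (sym (*-distribˡ-sum (w u v) (λ i → let θ = Inverse.to characters i in a θ * h θ u v * b θ))))
           (swap r (w u v) _))) ⟩
    e * ∑𝔽² (λ u v → w u v * (r * ∑[ θ ∈ characters ] (a θ * h θ u v * b θ))) ∎
    where
    swap : ∀ x y z → x * (y * z) ≈ y * (x * z)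
    swap = solve 3 (λ x y z → x ⊕ (y ⊕ z) ⊜ y ⊕ (x ⊕ z)) refl
    g : Character → F.Carrier → F.Carrier → Carrier
    g θ u v = w u v * (a θ * h θ u v * b θ)
    expand : ∀ θ → a θ * (e * ∑𝔽² (λ u v → w u v * h θ u v)) * b θ ≈ e * ∑𝔽² (g θ)
    expand θ = begin
      a θ * (e * ∑𝔽² (λ u v → w u v * h θ u v)) * b θ
        ≈⟨ solve 4 (λ a e s b → (a ⊕ (e ⊕ s)) ⊕ b ⊜ e ⊕ (s ⊕ (a ⊕ b))) refl (a θ) e (∑𝔽² (λ u v → w u v * h θ u v)) (b θ) ⟩
      e * (∑𝔽² (λ u v → w u v * h θ u v) * (a θ * b θ))
        ≈⟨ *-congˡ (∑𝔽²-*ʳ (λ u v → w u v * h θ u v) (a θ * b θ)) ⟩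
      e * ∑𝔽² (λ u v → w u v * h θ u v * (a θ * b θ))
        ≈⟨ *-congˡ (∑𝔽²-cong (λ u v → solve 4 (λ w h a b → (w ⊕ h) ⊕ (a ⊕ b) ⊜ w ⊕ ((a ⊕ h) ⊕ b)) refl
             (w u v) (h θ u v) (a θ) (b θ))) ⟩
      e * ∑𝔽² (g θ) ∎

  -- The bracket has the shape of the kernel: `f` leads to the rescaled F₂, the constant 1 to the
  -- product of binomials, and `g` to `F₂ ε`.
  linear-combination : ∀ (w f g : F.Carrier → F.Carrier → Carrier) e a b c →
    e * ∑𝔽² (λ u v → w u v * (a * f u v + (b * 1# + c * g u v))) ≈
    a * (e * ∑𝔽² (λ u v → w u v * f u v)) + (b * (e * ∑𝔽² w) + c * (e * ∑𝔽² (λ u v → w u v * g u v)))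
  linear-combination w f g e a b c = begin
    e * ∑𝔽² (λ u v → w u v * (a * f u v + (b * 1# + c * g u v)))
      ≈⟨ *-congˡ (∑𝔽²-cong (λ u v → NS.solve 6 (λ w f g a b c →
           w NS.:* (a NS.:* f NS.:+ (b NS.:* NS.con 1 NS.:+ c NS.:* g)) NS.:=
           a NS.:* (w NS.:* f) NS.:+ (b NS.:* w NS.:+ c NS.:* (w NS.:* g))) refl (w u v) (f u v) (g u v) a b c)) ⟩
    e * ∑𝔽² (λ u v → a * wf u v + (b * w u v + c * wg u v))
      ≈⟨ *-congˡ (trans (∑𝔽²-+ (λ u v → a * wf u v) (λ u v → b * w u v + c * wg u v))
                        (+-cong (sym (∑𝔽²-*ˡ a wf))
                                (trans (∑𝔽²-+ (λ u v → b * w u v) (λ u v → c * wg u v))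
                                       (+-cong (sym (∑𝔽²-*ˡ b w)) (sym (∑𝔽²-*ˡ c wg)))))) ⟩
    e * (a * ∑𝔽² wf + (b * ∑𝔽² w + c * ∑𝔽² wg))
      ≈⟨ NS.solve 7 (λ e a b c x y z → e NS.:* (a NS.:* x NS.:+ (b NS.:* y NS.:+ c NS.:* z)) NS.:=
           a NS.:* (e NS.:* x) NS.:+ (b NS.:* (e NS.:* y) NS.:+ c NS.:* (e NS.:* z))) refl e a b c (∑𝔽² wf) (∑𝔽² w) (∑𝔽² wg) ⟩
    a * (e * ∑𝔽² wf) + (b * (e * ∑𝔽² w) + c * (e * ∑𝔽² wg)) ∎
    where
    wf wg : F.Carrier → F.Carrier → Carrier
    wf u v = w u v * f u v
    wg u v = w u v * g u v

  module _ (B B′ C C′ : Character) where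

    W : F.Carrier → F.Carrier → Carrier
    W u v = B ⟨ u ⟩ * B′ ⟨ v ⟩ * (B ⁻¹ ∙ C) ⟨ F.1# F.- u ⟩ * (B′ ⁻¹ ∙ C′) ⟨ F.1# F.- v ⟩

    prefactor : F.Carrier → F.Carrier → Carrier
    prefactor x y = ε ⟨ x F.* y ⟩ * (B ∙ B′ ∙ C ∙ C′) ⟨ -1F ⟩

    -- Without the factor coupling u and v the double sum is a product of two binomial integrals.
    -- The ε(y) is what remains of ε(xy) for x ≠ 0.
    binom-product : ∀ {x} → x F.≉ F.0# → ∀ y →
                    prefactor x y * ∑𝔽² W ≈ binom B C * binom B′ C′ * ε ⟨ y ⟩
    binom-product {x} x≉0 y = begin
      prefactor x y * ∑𝔽² W
        ≈⟨ *-cong (*-congʳ (trans (χ-* ε x y) (trans (*-congʳ (ε-one x≉0)) (*-identityˡ _))))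
                  (trans (∑𝔽²-cong (λ u v → solve 4 (λ a b c d → ((a ⊕ b) ⊕ c) ⊕ d ⊜ (a ⊕ c) ⊕ (b ⊕ d)) refl
                           (B ⟨ u ⟩) (B′ ⟨ v ⟩) ((B ⁻¹ ∙ C) ⟨ F.1# F.- u ⟩) ((B′ ⁻¹ ∙ C′) ⟨ F.1# F.- v ⟩)))
                         (∑𝔽²-product β β′)) ⟩
      ε ⟨ y ⟩ * (b * b′ * c₁ * c₁′) * (∑𝔽 β * ∑𝔽 β′)
        ≈⟨ solve 7 (λ e b b′ c c′ s s′ → (e ⊕ (((b ⊕ b′) ⊕ c) ⊕ c′)) ⊕ (s ⊕ s′) ⊜
                      (((b ⊕ c) ⊕ s) ⊕ ((b′ ⊕ c′) ⊕ s′)) ⊕ e) refl (ε ⟨ y ⟩) b b′ c₁ c₁′ (∑𝔽 β) (∑𝔽 β′) ⟩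
      (B ∙ C) ⟨ -1F ⟩ * ∑𝔽 β * ((B′ ∙ C′) ⟨ -1F ⟩ * ∑𝔽 β′) * ε ⟨ y ⟩
        ≈⟨ *-congʳ (*-cong (binom-integral B C) (binom-integral B′ C′)) ⟨
      binom B C * binom B′ C′ * ε ⟨ y ⟩ ∎
      where
      b b′ c₁ c₁′ : Carrier
      b = B ⟨ -1F ⟩
      b′ = B′ ⟨ -1F ⟩
      c₁ = C ⟨ -1F ⟩
      c₁′ = C′ ⟨ -1F ⟩
      β β′ : F.Carrier → Carrier
      β u = B ⟨ u ⟩ * (B ⁻¹ ∙ C) ⟨ F.1# F.- u ⟩
      β′ v = B′ ⟨ v ⟩ * (B′ ⁻¹ ∙ C′) ⟨ F.1# F.- v ⟩

    prefactor-scale : ∀ {a} → a F.≉ F.0# → ∀ x y → prefactor (x F./ a) (y F./ a) ≈ prefactor x y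
    prefactor-scale {a} a≉0 x y = *-congʳ (begin
      ε ⟨ x F./ a F.* (y F./ a) ⟩
        ≈⟨ trans (χ-* ε _ _) (*-cong (scale x) (scale y)) ⟩
      ε ⟨ x ⟩ * ε ⟨ y ⟩
        ≈⟨ χ-* ε x y ⟨
      ε ⟨ x F.* y ⟩ ∎)
      where
      scale : ∀ z → ε ⟨ z F./ a ⟩ ≈ ε ⟨ z ⟩
      scale z = trans (χ-* ε _ _) (trans (*-congˡ (ε-one (FP.x⁻¹≉0 a≉0))) (*-identityʳ _))

    module _ (char0 : CharacteristicZero) (ζ : Carrier) (ζ-primitive : IsPrimitiveRoot (q ∸ 1) ζ)
             {m : ℕ} (characters : Enumeration m characterSetoid) where

      generating-function : ∀ A {x t} y → x F.≉ F.0# → t F.≉ F.0# → t F.≉ F.1# →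
        1/[q-1] char0 * (∑[ θ ∈ characters ] (binom (A ∙ θ) θ * F₂ (A ∙ θ) B B′ C C′ x y * θ ⟨ t ⟩)) ≈
        A ⁻¹ ⟨ F.1# F.- t ⟩ * F₂ A B B′ C C′ (x F./ (F.1# F.- t)) (y F./ (F.1# F.- t))
        - A ⁻¹ ⟨ F.- t ⟩ * (binom B C * binom B′ C′ * ε ⟨ y ⟩ - F₂ ε B B′ C C′ x y)
      generating-function A {x} {t} y x≉0 t≉0 t≉1 = begin
        1/[q-1] char0 * (∑[ θ ∈ characters ] (binom (A ∙ θ) θ * F₂ (A ∙ θ) B B′ C C′ x y * θ ⟨ t ⟩))
          ≈⟨ weighted-mean characters (1/[q-1] char0) (prefactor x y) W
               (λ θ → binom (A ∙ θ) θ) (λ θ → θ ⟨ t ⟩) (λ θ u v → (A ∙ θ) ⁻¹ ⟨ s u v ⟩) ⟩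
        prefactor x y * ∑𝔽² (λ u v → W u v * (1/[q-1] char0 *
          ∑[ θ ∈ characters ] (binom (A ∙ θ) θ * (A ∙ θ) ⁻¹ ⟨ s u v ⟩ * θ ⟨ t ⟩)))
          ≈⟨ *-congˡ (∑𝔽²-cong (λ u v → *-congˡ {W u v} (trans
               (kernel char0 ζ ζ-primitive characters A (s u v) t≉0)
               (+-cong (trans (Character.cong (A ⁻¹) (rescale t≉1 x y u v)) (χ-* (A ⁻¹) _ _))
                       -- ε is replaced by its inverse because the last factor of `F₂ ε` is `ε ⁻¹`.
                       (trans (-[a[b-c]]≈-ab+ac _ _ _) (+-congˡ (*-congˡ (sym (ε⁻¹≈ε _))))))))) ⟩
        prefactor x y * ∑𝔽² (λ u v → W u v * (α * A ⁻¹ ⟨ s′ u v ⟩ + (- β * 1# + β * ε ⁻¹ ⟨ s u v ⟩)))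
          ≈⟨ linear-combination W (λ u v → A ⁻¹ ⟨ s′ u v ⟩) (λ u v → ε ⁻¹ ⟨ s u v ⟩) (prefactor x y) α (- β) β ⟩
        α * (prefactor x y * ∑𝔽² (λ u v → W u v * A ⁻¹ ⟨ s′ u v ⟩)) +
        (- β * (prefactor x y * ∑𝔽² W) + β * F₂ ε B B′ C C′ x y)
          ≈⟨ +-cong (*-congˡ (*-congʳ (sym (prefactor-scale 1-t≉0 x y)))) (+-congʳ (*-congˡ (binom-product x≉0 y))) ⟩
        α * F₂ A B B′ C C′ x′ y′ + (- β * (binom B C * binom B′ C′ * ε ⟨ y ⟩) + β * F₂ ε B B′ C C′ x y)
          ≈⟨ +-congˡ (-[a[b-c]]≈-ab+ac _ _ _) ⟨
        α * F₂ A B B′ C C′ x′ y′ - β * (binom B C * binom B′ C′ * ε ⟨ y ⟩ - F₂ ε B B′ C C′ x y) ∎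
        where
        x′ y′ : F.Carrier
        x′ = x F./ (F.1# F.- t)
        y′ = y F./ (F.1# F.- t)
        s s′ : F.Carrier → F.Carrier → F.Carrier
        s u v = F.1# F.- u F.* x F.- v F.* y
        s′ u v = F.1# F.- u F.* x′ F.- v F.* y′
        α β : Carrier
        α = A ⁻¹ ⟨ F.1# F.- t ⟩
        β = A ⁻¹ ⟨ F.- t ⟩
        1-t≉0 : F.1# F.- t F.≉ F.0#
        1-t≉0 = FP.x-y≉0 (λ 1≈t → t≉1 (F.sym 1≈t))

  -- In terms of arguments: (-x)⁻¹ · (-1) · (-x/t) = (-t)⁻¹.
  A[-x]-factor : ∀ A {x t} → x F.≉ F.0# →
    A ⁻¹ ⟨ F.- x ⟩ * (A ⟨ -1F ⟩ * A ⟨ F.- (x F./ t) ⟩) ≈ A ⁻¹ ⟨ F.- t ⟩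
  A[-x]-factor A {x} {t} x≉0 = begin
    A ⁻¹ ⟨ F.- x ⟩ * (a * A ⟨ F.- (x F./ t) ⟩)
      ≈⟨ *-cong (trans (χ-neg (A ⁻¹) x) (*-congʳ (χ⁻¹-neg1 A)))
                (*-congˡ (trans (χ-neg A _) (*-congˡ (trans (χ-* A x _) (*-congˡ (sym (χ⁻¹-value A t))))))) ⟩
    a * A ⁻¹ ⟨ x ⟩ * (a * (a * (A ⟨ x ⟩ * A ⁻¹ ⟨ t ⟩)))
      ≈⟨ solve 4 (λ a i x t → (a ⊕ i) ⊕ (a ⊕ (a ⊕ (x ⊕ t))) ⊜ ((a ⊕ a) ⊕ (i ⊕ x)) ⊕ (a ⊕ t)) refl a _ _ _ ⟩
    a * a * (A ⁻¹ ⟨ x ⟩ * A ⟨ x ⟩) * (a * A ⁻¹ ⟨ t ⟩)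
      ≈⟨ trans (*-congʳ (trans (*-cong (-1²≈1 A) (χ⁻¹-* A x≉0)) (*-identityˡ 1#))) (*-identityˡ _) ⟩
    a * A ⁻¹ ⟨ t ⟩
      ≈⟨ trans (χ-neg (A ⁻¹) t) (*-congʳ (χ⁻¹-neg1 A)) ⟨
    A ⁻¹ ⟨ F.- t ⟩ ∎
    where a = A ⟨ -1F ⟩

  -- The sign BC(-1) produced by the inversion meets the one in front, and their product is 1. The
  -- parameters `d` and `e` stand for the two factors in y common to both terms.
  ₂F₁-terms-agree : ∀ A B C {x t} → x F.≉ F.0# → t F.≉ F.0# → ∀ d e →
    (B ∙ C) ⟨ -1F ⟩ * A ⁻¹ ⟨ F.- x ⟩ * d * e * ₂F₁ A (A ∙ C ⁻¹) (A ∙ B ⁻¹) (F.- (t F./ x)) ≈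
    A ⁻¹ ⟨ F.- t ⟩ * d * e * ₂F₁ A B C (F.- (x F./ t))
  ₂F₁-terms-agree A B C {x} {t} x≉0 t≉0 d e = begin
    bc * A ⁻¹ ⟨ F.- x ⟩ * d * e * ₂F₁ A (A ∙ C ⁻¹) (A ∙ B ⁻¹) (F.- (t F./ x))
      ≈⟨ *-congˡ (₂F₁-inversion A B C (-[x/t]*-[t/x]≈1 x≉0 t≉0)) ⟩
    bc * A ⁻¹ ⟨ F.- x ⟩ * d * e * (A ⟨ -1F ⟩ * A ⟨ X ⟩ * bc * ₂F₁ A B C X)
      ≈⟨ solve 7 (λ bc i d e a x f → (((bc ⊕ i) ⊕ d) ⊕ e) ⊕ (((a ⊕ x) ⊕ bc) ⊕ f) ⊜
                                     (bc ⊕ bc) ⊕ ((((i ⊕ (a ⊕ x)) ⊕ d) ⊕ e) ⊕ f)) refl bc _ d e _ _ _ ⟩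
    bc * bc * (A ⁻¹ ⟨ F.- x ⟩ * (A ⟨ -1F ⟩ * A ⟨ X ⟩) * d * e * ₂F₁ A B C X)
      ≈⟨ trans (*-congʳ (-1²≈1 (B ∙ C))) (*-identityˡ _) ⟩
    A ⁻¹ ⟨ F.- x ⟩ * (A ⟨ -1F ⟩ * A ⟨ X ⟩) * d * e * ₂F₁ A B C X
      ≈⟨ *-congʳ (*-congʳ (*-congʳ (A[-x]-factor A x≉0))) ⟩
    A ⁻¹ ⟨ F.- t ⟩ * d * e * ₂F₁ A B C X ∎
    where
    X = F.- (x F./ t)
    bc = (B ∙ C) ⟨ -1F ⟩

  -- Here `c` is the ₂F₁ term in -x/t; its second occurrence is afterwards rewritten with argument
  -- -t/x.
  a-b≈a-c-b+c : ∀ a b c → a - b ≈ a - c - b + c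
  a-b≈a-c-b+c a b c = sym (begin
    a - c - b + c
      ≈⟨ NS.solve 4 (λ a b c d → ((a NS.:+ c) NS.:+ b) NS.:+ d NS.:= (a NS.:+ b) NS.:+ (c NS.:+ d)) refl a (- b) (- c) c ⟩
    a - b + (- c + c)
      ≈⟨ trans (+-congˡ (-‿inverseˡ c)) (+-identityʳ _) ⟩
    a - b ∎)

theorem4p1 : ∀ {c ℓ k ℓ₁ ℓ₂} {q : ℕ} → IsPrimePower q →
    (𝔽 : FiniteField q c ℓ) (K : HeytingField k ℓ₁ ℓ₂) →
    let open Characters 𝔽 K in
    (char0 : CharacteristicZero) →
    (ζ : Carrier) → IsPrimitiveRoot (q ∸ 1) ζ →
    {m : ℕ} (characters : Enumeration m characterSetoid) →
    (A B B′ C C′ : Character) →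
    (x y t : F.Carrier) → x F.≉ F.0# → t F.≉ F.0# → t F.≉ F.1# →
    1/[q-1] char0 *
    (∑[ θ ∈ characters ] (binom (A ∙ θ) θ * F₂ (A ∙ θ) B B′ C C′ x y * θ ⟨ t ⟩))
    ≈ A ⁻¹ ⟨ F.1# F.- t ⟩ * F₂ A B B′ C C′ (x F./ (F.1# F.- t)) (y F./ (F.1# F.- t))
    - A ⁻¹ ⟨ F.- t ⟩ * C′ ⁻¹ ⟨ y ⟩ * (B′ ⁻¹ ∙ C′) ⟨ F.1# F.- y ⟩ * ₂F₁ A B C (F.- (x F./ t))
    - A ⁻¹ ⟨ F.- t ⟩ * (binom B C * binom B′ C′ * ε ⟨ y ⟩ - F₂ ε B B′ C C′ x y)
    + (B ∙ C) ⟨ -1F ⟩ * A ⁻¹ ⟨ F.- x ⟩ * C′ ⁻¹ ⟨ y ⟩ * (B′ ⁻¹ ∙ C′) ⟨ F.1# F.- y ⟩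
    * ₂F₁ A (A ∙ C ⁻¹) (A ∙ B ⁻¹) (F.- (t F./ x))
theorem4p1 _ 𝔽 K char0 ζ ζ-primitive characters A B B′ C C′ x y t x≉0 t≉0 t≉1 =
  trans (generating-function B B′ C C′ char0 ζ ζ-primitive characters A y x≉0 t≉0 t≉1)
    (trans (a-b≈a-c-b+c _ _ _) (+-congˡ (sym (₂F₁-terms-agree A B C x≉0 t≉0 _ _))))
  where
  open Characters 𝔽 K
  open Appell 𝔽 K
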